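{- There is $k_1$ such that for every even integer $k> k_1$, every even integer $n\ge k$, and every integer $i$ with $k/2<i<k$, $$N(CM,k,n)\ge \frac{n(5ik-k+i+i^2)-2(k-i)}{(2k+3+i)\,ik}.$$ In particular, for every $\varepsilon>0$ there is $k_0$ such that for every even $k>k_0$ there is $n_0(k)$ such that for every even $n>n_0(k)$, $N(CM,k,n)>(11/5-\varepsilon)\,n/k$.
   Context: Majority problem: we are given $n$ balls indexed by $[n]=\{1,\dots,n\}$, each colored by one of two colors by an unknown coloring. A ball $i$ is a majority ball if more than $n/2$ balls (counting $i$) have the same color as $i$. The goal is to either identify a majority ball or correctly conclude that there is none. A query is a $k$-element subset $Q\subseteq[n]$. In the non-adaptive version, a family of queries is fixed in advance; it is successful if for every coloring the answers determine a correct output (a ball that is a majority ball for every coloring consistent with the answers, or the conclusion that no majority ball exists for every coloring consistent with the answers). In the Counting Model (CM), the answer to a query $Q$ is the number $j\le k/2$ such that $Q$ contains exactly $j$ balls of one of the colors (and hence $k-j$ balls of the other color). $N(CM,k,n)$ is the minimum number of queries in a successful non-adaptive query family in this model. -}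

module Defs where

open import Data.Nat using (ℕ; zero; suc; _+_; _*_; _∸_; _<_; _⊓_)
open import Data.Bool using (Bool; true; false; if_then_else_; _∧_; not; _xor_)
open import Data.Fin using (Fin; zero; suc)
open import Data.List using (List; map)
open import Data.List.Relation.Unary.All using (All)
open import Data.Maybe using (Maybe; just; nothing)
open import Data.Product using (∃)
open import Relation.Nullary using (¬_)
open import Relation.Binary.PropositionalEquality using (_≡_)

Coloring : ℕ → Set
Coloring n = Fin n → Bool

Query : ℕ → Set
Query n = Fin n → Bool

count : ∀ {n} → (Fin n → Bool) → ℕ
count {zero}  f = 0
count {suc n} f = (if f zero then 1 else 0) + count (λ j → f (suc j))

IsMajority : ∀ {n} → Coloring n → Fin n → Set
IsMajority {n} c b = n < 2 * count (λ j → not (c j xor c b))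

-- Counting Model answer: the number j ≤ |Q|/2 of balls of the minority color in Q
answer : ∀ {n} → Coloring n → Query n → ℕ
answer c Q = t ⊓ (count Q ∸ t)
  where t = count (λ j → Q j ∧ c j)

answers : ∀ {n} → List (Query n) → Coloring n → List ℕ
answers F c = map (answer c) F

CorrectOutput : ∀ {n} → Coloring n → Maybe (Fin n) → Set
CorrectOutput c (just b) = IsMajority c b
CorrectOutput c nothing  = ∀ b → ¬ IsMajority c b

IsKFamily : ∀ {n} → ℕ → List (Query n) → Set
IsKFamily k F = All (λ Q → count Q ≡ k) F

Successful : ∀ {n} → List (Query n) → Set
Successful {n} F =
  ∀ (c : Coloring n) → ∃ λ (o : Maybe (Fin n)) →
    ∀ (c' : Coloring n) → answers F c' ≡ answers F c → CorrectOutput c' o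

{-# OPTIONS --safe #-}

-- Both parts follow from 11 n ≤ 5 k |F| for all even k > 200 and even n ≥ k.
--
-- Let S carry signs ±1 whose sum over every query is zero, and extend them to a balanced
-- coloring. Recoloring S keeps all answers, so by success the sum of the signs must vanish.
-- But then negating one sign, at a ball x in at most two queries, gives a total of ∓2, and the
-- answers still survive if the balls outside S are balanced inside the queries through x.
--
-- If 11 n > 5 k |F|, then more than 4n/15 balls lie in at most two queries. For n greater than
-- 2 k + 3 |F| + 1, choose 3 |F| + 1 of them: two of their subsets meet every query in equally many balls,
-- and their symmetric difference is S. Otherwise |F| ≤ 4 and S consists of two balls lying in
-- the same queries.

module Submission where

open import Defs
open import Data.Nat using (ℕ; zero; suc; _+_; _*_; _∸_; _^_; _⊓_; _<_; _≤_;
    z≤n; s≤s; s≤s⁻¹; _≤ᵇ_; _≡ᵇ_; _≤?_; _<?_)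
open import Data.Nat.Properties hiding (_≟_)
import Data.Nat.Properties as ℕ
open import Data.Nat.Divisibility using (_∣_; divides; _∣?_; ∣m+n∣m⇒∣n; ∣m∣n⇒∣m+n; _∣0)
open import Data.Nat.ListAction using (sum; product)
open import Data.Nat.Tactic.RingSolver using (solve-∀)
open import Algebra.Properties.CommutativeSemigroup +-commutativeSemigroup using (interchange)
open import Data.Bool using (Bool; true; false; T; if_then_else_; _∧_; _∨_; not; _xor_)
import Data.Bool.Properties as Bool
open import Data.Fin using (Fin; zero; suc; _≟_)
open import Data.Vec using (Vec; []; _∷_; lookup)
import Data.Vec as Vec
open import Data.List using (List; []; _∷_; _++_; length; map; filter; tabulate; allFin)
open import Data.List.Properties using (length-++; length-map)
open import Data.List.Membership.Propositional using (_∈_)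
open import Data.List.Membership.Propositional.Properties using (∈-filter⁺; ∈-filter⁻; ∈-map⁻; ∈-++⁻)
open import Data.List.Relation.Unary.All using (All; []; _∷_)
import Data.List.Relation.Unary.All as All
open import Data.List.Relation.Unary.Any using (here; there)
open import Data.List.Relation.Unary.Unique.Propositional using (Unique; []; _∷_)
import Data.List.Relation.Unary.Unique.Propositional.Properties as Unique
open import Data.Maybe using (just; nothing)
open import Data.Product using (_×_; ∃; ∃₂; _,_; proj₁; proj₂)
open import Data.Sum using (_⊎_; inj₁; inj₂)
open import Data.Empty using (⊥)
open import Function using (_∘_; case_of_; Equivalence)
open import Relation.Nullary using (¬_; Dec; yes; no; does; contradiction)
open import Relation.Nullary.Decidable using (¬?; dec-true; dec-false)
open import Relation.Binary.Definitions using (tri<; tri≈; tri>)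
open import Relation.Binary.PropositionalEquality

-- The limit of two queries through x makes the coloring outside S easy. They cut it into four cells
-- whose sizes agree in parity, because k and n are even and S takes evenly many balls from each
-- set; balance in both queries with a surplus of two is then a matter of parity and a little room.
--
-- The number 3 |F| + 1 comes from (1 + d)^3 ≤ 2^(3 + d). The vectors of intersection sizes with
-- subsets of E number at most the product of the 1 + |E ∩ Q|. If the balls of E have degree at most
-- two, the cube of this product is at most 2^(3 |F| + 2 |E|), which is below 2^(3 |E|) as soon as
-- |E| > 3 |F|.
--
-- The constant 11/5 is the value at i = k/2 of (5k + i) / (2k + i), which decreases in i and
-- governs the first bound for large k. The share 4/15 is (3 - 11/5) / 3, as each ball of higher
-- degree takes at least three of the k |F| incidences.

infixr 6 _∩_

-- Subsets as Boolean functions and relations between their sizes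

_∩_ : ∀ {n} → (Fin n → Bool) → (Fin n → Bool) → Fin n → Bool
(p ∩ q) j = p j ∧ q j

∁ : ∀ {n} → (Fin n → Bool) → Fin n → Bool
∁ p j = not (p j)

∅ : ∀ {n} → Fin n → Bool
∅ _ = false

⁅_⁆ : ∀ {n} → Fin n → Fin n → Bool
⁅ x ⁆ j = does (x ≟ j)

𝟙 : Bool → ℕ
𝟙 b = if b then 1 else 0

-- A linear relation between the sizes of Boolean combinations of m sets holds
-- as soon as it holds for the indicators at each of the 2 ^ m truth values.

Formula : ℕ → Set
Formula zero    = Bool
Formula (suc m) = Bool → Formula m

eval : ∀ {m} → Formula m → Vec Bool m → Bool
eval e []      = e
eval e (b ∷ v) = eval (e b) v

-- The clause for a single formula here and in `sizes` avoids a trailing `+ 0`, so that the sums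
-- unfold to exactly the terms occurring in the equations where they are used.
weight : ∀ {m} → List (Formula m) → Vec Bool m → ℕ
weight []           v = 0
weight (e ∷ [])     v = 𝟙 (eval e v)
weight (e ∷ f ∷ es) v = 𝟙 (eval e v) + weight (f ∷ es) v

sizes : ∀ {m n} → List (Formula m) → (Fin n → Vec Bool m) → ℕ
sizes []           V = 0
sizes (e ∷ [])     V = count (λ j → eval e (V j))
sizes (e ∷ f ∷ es) V = count (λ j → eval e (V j)) + sizes (f ∷ es) V

sizes-zero : ∀ {m} (es : List (Formula m)) (V : Fin 0 → Vec Bool m) → sizes es V ≡ 0
sizes-zero []           V = refl
sizes-zero (e ∷ [])     V = refl
sizes-zero (e ∷ f ∷ es) V = sizes-zero (f ∷ es) V

sizes-suc : ∀ {m n} (es : List (Formula m)) (V : Fin (suc n) → Vec Bool m) →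
            sizes es V ≡ weight es (V zero) + sizes es (V ∘ suc)
sizes-suc []           V = refl
sizes-suc (e ∷ [])     V = refl
sizes-suc (e ∷ f ∷ es) V rewrite sizes-suc (f ∷ es) V =
  interchange (𝟙 (eval e (V zero))) _ (weight (f ∷ es) (V zero)) _

everywhere : ∀ m → (Vec Bool m → Bool) → Bool
everywhere zero    f = f []
everywhere (suc m) f = everywhere m (f ∘ (true ∷_)) ∧ everywhere m (f ∘ (false ∷_))

everywhere-sound : ∀ {m} (f : Vec Bool m → Bool) → T (everywhere m f) → ∀ v → T (f v)
everywhere-sound f t []          = t
everywhere-sound f t (true ∷ v)  = everywhere-sound (f ∘ (true ∷_)) (proj₁ (Equivalence.to Bool.T-∧ t)) v
everywhere-sound {suc m} f t (false ∷ v) = everywhere-sound (f ∘ (false ∷_))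
  (proj₂ (Equivalence.to (Bool.T-∧ {everywhere m (f ∘ (true ∷_))}) t)) v

-- The unnamed implicit argument is a truth table check. For concrete formulas it evaluates to the
-- unit type and is filled in automatically, so such a relation is proved by naming its two sides.
count-≤ : ∀ {m n} (es fs : List (Formula m)) {_ : T (everywhere m (λ v → weight es v ≤ᵇ weight fs v))}
          (V : Fin n → Vec Bool m) → sizes es V ≤ sizes fs V
count-≤ {m} {zero} es fs V = ≤-reflexive (trans (sizes-zero es V) (sym (sizes-zero fs V)))
count-≤ {m} {suc n} es fs {t} V rewrite sizes-suc es V | sizes-suc fs V =
  +-mono-≤ (≤ᵇ⇒≤ _ _ (everywhere-sound {m} (λ v → weight es v ≤ᵇ weight fs v) t (V zero)))
           (count-≤ es fs {t} (V ∘ suc))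

count-≡ : ∀ {m n} (es fs : List (Formula m)) {_ : T (everywhere m (λ v → weight es v ≡ᵇ weight fs v))}
          (V : Fin n → Vec Bool m) → sizes es V ≡ sizes fs V
count-≡ {m} {zero} es fs V = trans (sizes-zero es V) (sym (sizes-zero fs V))
count-≡ {m} {suc n} es fs {t} V rewrite sizes-suc es V | sizes-suc fs V =
  cong₂ _+_ (≡ᵇ⇒≡ _ _ (everywhere-sound {m} (λ v → weight es v ≡ᵇ weight fs v) t (V zero)))
            (count-≡ es fs {t} (V ∘ suc))

count-cong : ∀ {n} {p q : Fin n → Bool} → (∀ j → p j ≡ q j) → count p ≡ count q
count-cong {zero}  p≗q = refl
count-cong {suc n} p≗q = cong₂ _+_ (cong 𝟙 (p≗q zero)) (count-cong (p≗q ∘ suc))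

count-∅ : ∀ n → count {n} ∅ ≡ 0
count-∅ zero    = refl
count-∅ (suc n) = count-∅ n

count-all : ∀ n → count {n} (∁ ∅) ≡ n
count-all zero    = refl
count-all (suc n) = cong suc (count-all n)

count-∁ : ∀ {n} (p : Fin n → Bool) → count p + count (∁ p) ≡ n
count-∁ {n} p = trans (count-≡ ((λ b → b) ∷ (λ b → not b) ∷ []) ((λ _ → true) ∷ []) (λ j → p j ∷ []))
                      (count-all n)

count-⁅⁆ : ∀ {n} (x : Fin n) → count ⁅ x ⁆ ≡ 1
count-⁅⁆ {suc n} zero    = cong suc (count-∅ n)
count-⁅⁆ {suc n} (suc x) = count-⁅⁆ x

⁅⁆-refl : ∀ {n} (x : Fin n) → ⁅ x ⁆ x ≡ true
⁅⁆-refl x = dec-true (x ≟ x) refl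

⁅⁆-≢ : ∀ {n} {x y : Fin n} → x ≢ y → ⁅ x ⁆ y ≡ false
⁅⁆-≢ {x = x} {y} x≢y = dec-false (x ≟ y) x≢y

count-pos : ∀ {n} (p : Fin n → Bool) x → p x ≡ true → 1 ≤ count p
count-pos p zero    px rewrite px = s≤s z≤n
count-pos p (suc x) px = ≤-trans (count-pos (p ∘ suc) x px) (m≤n+m _ (𝟙 (p zero)))

count-pos⁻ : ∀ {n} (p : Fin n → Bool) → 1 ≤ count p → ∃ λ x → p x ≡ true
count-pos⁻ {suc n} p 1≤ with p zero in eq
... | true  = zero , eq
... | false with count-pos⁻ (p ∘ suc) 1≤
...   | x , px = suc x , px

full : ∀ {n} (p : Fin n → Bool) → count p ≡ n → ∀ j → p j ≡ true
full {n} p eq j with p j in pj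
... | true  = refl
... | false = contradiction (count-pos (∁ p) j (cong not pj))
  (λ 1≤ → 1+n≰n (≤-trans 1≤ (≤-reflexive
     (+-cancelˡ-≡ (count p) _ 0 (trans (count-∁ p) (sym (trans (+-identityʳ _) eq)))))))

bisect : ∀ {n} (p : Fin n → Bool) a b → count p ≡ a + b →
         ∃ λ u → count (p ∩ u) ≡ a × count (p ∩ ∁ u) ≡ b
bisect {zero}  p zero    b eq = (λ ()) , refl , eq
bisect {suc n} p a b eq with p zero
bisect {suc n} p a b eq | false with bisect (p ∘ suc) a b eq
... | u , a≡ , b≡ = (λ { zero → true ; (suc j) → u j }) , a≡ , b≡
bisect {suc n} p zero (suc b) eq | true with bisect (p ∘ suc) zero b (suc-injective eq)
... | u , a≡ , b≡ = (λ { zero → false ; (suc j) → u j }) , a≡ , cong suc b≡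
bisect {suc n} p (suc a) b eq | true with bisect (p ∘ suc) a b (suc-injective eq)
... | u , a≡ , b≡ = (λ { zero → true ; (suc j) → u j }) , cong suc a≡ , b≡

-- Majority, balance and recolorings that preserve the answers

majority-size : ∀ {n} (c : Coloring n) b → c b ≡ true →
                count (λ j → not (c j xor c b)) ≡ count c
majority-size c b cb = count-cong λ j → trans (cong (λ z → not (c j xor z)) cb)
  (trans (cong not (Bool.xor-comm (c j) true)) (Bool.not-involutive (c j)))

minority-size : ∀ {n} (c : Coloring n) b → c b ≡ false →
                count (λ j → not (c j xor c b)) ≡ count (∁ c)
minority-size c b cb = count-cong λ j → cong not
  (trans (cong (c j xor_) cb) (Bool.xor-identityʳ (c j)))

a<b⇒a+b<2b : ∀ {a b} → a < b → a + b < 2 * b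
a<b⇒a+b<2b {a} {b} a<b = ≤-trans (+-monoˡ-< b a<b) (≤-reflexive (cong (b +_) (sym (+-identityʳ b))))

balanced⇒¬majority : ∀ {n} (c : Coloring n) → count c ≡ count (∁ c) → ∀ b → ¬ IsMajority c b
balanced⇒¬majority {n} c bal b maj = <-irrefl (sym (trans (cong (2 *_) half) twice)) maj
  where
  half : count (λ j → not (c j xor c b)) ≡ count c
  half with c b Bool.≟ true
  ... | yes cb = majority-size c b cb
  ... | no ¬cb = trans (minority-size c b (Bool.¬-not ¬cb)) (sym bal)
  twice : 2 * count c ≡ n
  twice = trans (cong (count c +_) (trans (+-identityʳ _) bal)) (count-∁ c)

¬majority⇒balanced : ∀ {n} (c : Coloring n) → (∀ b → ¬ IsMajority c b) → count c ≡ count (∁ c)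
¬majority⇒balanced {n} c none with <-cmp (count c) (count (∁ c))
... | tri≈ _ eq _ = eq
... | tri< lt _ _ with count-pos⁻ (∁ c) (≤-trans (s≤s z≤n) lt)
...   | b , cb = contradiction
  (subst₂ (λ u v → u < 2 * v) (count-∁ c)
    (sym (minority-size c b (Bool.not-injective cb)))
    (a<b⇒a+b<2b lt))
  (none b)
¬majority⇒balanced {n} c none | tri> _ _ gt with count-pos⁻ c (≤-trans (s≤s z≤n) gt)
... | b , cb = contradiction
  (subst₂ (λ u v → u < 2 * v) (trans (+-comm (count (∁ c)) _) (count-∁ c))
    (sym (majority-size c b cb))
    (a<b⇒a+b<2b gt))
  (none b)

-- An answer is the smaller of the two color counts in `Q`, so it survives both an unchanged count
-- and an exchange of the two counts; the second alternative is the exchange.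
answer-≡ : ∀ {n} {c c' : Coloring n} (Q : Query n) →
  count (Q ∩ c') ≡ count (Q ∩ c) ⊎ count Q ≡ count (Q ∩ c) + count (Q ∩ c') →
  answer c' Q ≡ answer c Q
answer-≡ Q (inj₁ eq) = cong (λ t → t ⊓ (count Q ∸ t)) eq
answer-≡ {c = c} {c'} Q (inj₂ eq) rewrite eq
  | m+n∸m≡n (count (Q ∩ c)) (count (Q ∩ c'))
  | m+n∸n≡m (count (Q ∩ c)) (count (Q ∩ c')) = ⊓-comm (count (Q ∩ c')) _

answers-≡ : ∀ {n} {c c' : Coloring n} {F : List (Query n)} →
  All (λ Q → answer c' Q ≡ answer c Q) F → answers F c' ≡ answers F c
answers-≡ []         = refl
answers-≡ (eq ∷ eqs) = cong₂ _∷_ eq (answers-≡ eqs)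

-- A balanced coloring has no majority ball, so the output for `c` must be `nothing`; it has to be
-- correct for `c'` too, and only a balanced coloring has no majority ball.
successful-balanced : ∀ {n} {F : List (Query n)} → Successful F → (c c' : Coloring n) →
  answers F c' ≡ answers F c → count c ≡ count (∁ c) → count c' ≡ count (∁ c')
successful-balanced success c c' same bal with success c
... | just b  , h = contradiction (h c refl) (balanced⇒¬majority c bal b)
... | nothing , h = ¬majority⇒balanced c' (h c' same)

-- Recoloring S turns the surplus s + r of a color in Q (s from S, r from outside S)
-- into r - s, so the answer survives whenever s = 0 or r = 0.
flip-balanced : ∀ {n} {F : List (Query n)} → Successful F → (c S : Fin n → Bool) →
  All (λ Q → count (Q ∩ S ∩ c) ≡ count (Q ∩ S ∩ ∁ c) ⊎
             count (Q ∩ ∁ S ∩ c) ≡ count (Q ∩ ∁ S ∩ ∁ c)) F →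
  count c ≡ count (∁ c) → count (S ∩ c) ≡ count (S ∩ ∁ c)
flip-balanced {n} {F} success c S local bal =
  -- Balance before and after the recoloring makes both s + r and r - s vanish over the whole set,
  -- hence 2s = 0.
  cancel (count (S ∩ c)) (count (∁ S ∩ c)) (count (S ∩ ∁ c)) (count (∁ S ∩ ∁ c))
    (trans (count-≡ ((λ s c → s ∧ c) ∷ (λ s c → not s ∧ c) ∷ []) ((λ s c → c) ∷ []) V)
      (trans bal
        (count-≡ ((λ s c → not c) ∷ []) ((λ s c → s ∧ not c) ∷ (λ s c → not s ∧ not c) ∷ []) V)))
    (trans (count-≡ ((λ s c → s ∧ not c) ∷ (λ s c → not s ∧ c) ∷ []) ((λ s c → c xor s) ∷ []) V)
      (trans (successful-balanced success c c' (answers-≡ {c = c} {c'} (All.map (λ {Q} → same Q) local)) bal)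
        (count-≡ ((λ s c → not (c xor s)) ∷ []) ((λ s c → s ∧ c) ∷ (λ s c → not s ∧ not c) ∷ []) V)))
  where
  c' : Coloring n
  c' j = c j xor S j
  V : Fin n → Vec Bool 2
  V j = S j ∷ c j ∷ []
  same : ∀ Q → count (Q ∩ S ∩ c) ≡ count (Q ∩ S ∩ ∁ c) ⊎
               count (Q ∩ ∁ S ∩ c) ≡ count (Q ∩ ∁ S ∩ ∁ c) → answer c' Q ≡ answer c Q
  same Q h = answer-≡ {c = c} {c'} Q (case h of λ where
    (inj₁ s≡0) → inj₁ (trans
      (count-≡ ((λ q s c → q ∧ (c xor s)) ∷ []) ((λ q s c → q ∧ s ∧ not c) ∷ (λ q s c → q ∧ not s ∧ c) ∷ []) W)
      (trans (cong (_+ count (Q ∩ ∁ S ∩ c)) (sym s≡0))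
        (count-≡ ((λ q s c → q ∧ s ∧ c) ∷ (λ q s c → q ∧ not s ∧ c) ∷ []) ((λ q s c → q ∧ c) ∷ []) W)))
    (inj₂ r≡0) → inj₂ (trans
      (count-≡ ((λ q s c → q) ∷ [])
          ((λ q s c → q ∧ not s ∧ not c) ∷ (λ q s c → q ∧ s) ∷ (λ q s c → q ∧ not s ∧ c) ∷ []) W)
      (trans (cong (_+ (count (Q ∩ S) + count (Q ∩ ∁ S ∩ c))) (sym r≡0))
        (count-≡ ((λ q s c → q ∧ not s ∧ c) ∷ (λ q s c → q ∧ s) ∷ (λ q s c → q ∧ not s ∧ c) ∷ [])
                 ((λ q s c → q ∧ c) ∷ (λ q s c → q ∧ (c xor s)) ∷ []) W))))
    where
    W : Fin n → Vec Bool 3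
    W j = Q j ∷ S j ∷ c j ∷ []
  cancel : ∀ a ρ b τ → a + ρ ≡ b + τ → b + ρ ≡ a + τ → a ≡ b
  cancel a ρ b τ e₁ e₂ = *-cancelˡ-≡ a b 2 (+-cancelʳ-≡ (ρ + τ) _ _ (trans (lhs a ρ τ)
    (trans (cong₂ _+_ e₁ (sym e₂)) (rhs b ρ τ))))
    where
    lhs : ∀ a ρ τ → 2 * a + (ρ + τ) ≡ (a + ρ) + (a + τ)
    lhs = solve-∀
    rhs : ∀ b ρ τ → (b + τ) + (b + ρ) ≡ 2 * b + (ρ + τ)
    rhs = solve-∀

-- Parity and a coloring with surplus two

even⇒half : ∀ {a} → 2 ∣ a → ∃ λ h → a ≡ h + h
even⇒half (divides q eq) = q , trans eq (trans (*-comm q 2) (cong (q +_) (+-identityʳ q)))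

odd⇒half : ∀ {a} → ¬ 2 ∣ a → ∃ λ h → a ≡ suc (h + h)
odd⇒half {zero}        odd = contradiction (2 ∣0) odd
odd⇒half {suc zero}    odd = 0 , refl
odd⇒half {suc (suc a)} odd with odd⇒half {a} (λ even → odd (∣m∣n⇒∣m+n (divides 1 refl) even))
... | h , eq = suc h , cong (2 +_) (trans eq (sym (+-suc h h)))

∣m+n∣n⇒∣m : ∀ {d m n} → d ∣ m + n → d ∣ n → d ∣ m
∣m+n∣n⇒∣m {d} {m} {n} d∣m+n = ∣m+n∣m⇒∣n {d} {n} {m} (subst (d ∣_) (+-comm m n) d∣m+n)

-- Color counts p (first color) and q (second color) in the four cells of the Venn diagram of
-- two sets, with cells 1, 2 forming the first set and cells 2, 3 the second.
record Splitting (a b c d : ℕ) : Set where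
  field
    p₁ p₂ p₃ p₄ q₁ q₂ q₃ q₄ : ℕ
    a≡ : a ≡ p₁ + q₁
    b≡ : b ≡ p₂ + q₂
    c≡ : c ≡ p₃ + q₃
    d≡ : d ≡ p₄ + q₄
    first-balanced  : p₁ + p₂ ≡ q₁ + q₂
    second-balanced : p₂ + p₃ ≡ q₂ + q₃
    surplus         : p₁ + (p₂ + (p₃ + p₄)) ≡ 2 + (q₁ + (q₂ + (q₃ + q₄)))

-- The hypotheses force a, b, c, d to be all odd or all even. Odd cells get the surpluses +1, -1,
-- +1, +1. Even cells get 0, 0, 0, +2 if the last is nonempty, and otherwise +2, -2, +2, 0.
splitting : ∀ a b c d → 2 ∣ a + b → 2 ∣ b + c → 2 ∣ c + d →
            1 ≤ d ⊎ (1 ≤ a × 1 ≤ b × 1 ≤ c) → Splitting a b c d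
splitting a b c d 2∣ab 2∣bc 2∣cd room with 2 ∣? a
... | no odd-a = go (odd⇒half odd-a) (odd⇒half odd-b) (odd⇒half odd-c) (odd⇒half odd-d)
  where
  odd-b : ¬ 2 ∣ b
  odd-b = odd-a ∘ ∣m+n∣n⇒∣m 2∣ab
  odd-c : ¬ 2 ∣ c
  odd-c = odd-b ∘ ∣m+n∣n⇒∣m 2∣bc
  odd-d : ¬ 2 ∣ d
  odd-d = odd-c ∘ ∣m+n∣n⇒∣m 2∣cd
  go : ∃ (λ h → a ≡ suc (h + h)) → ∃ (λ h → b ≡ suc (h + h)) →
       ∃ (λ h → c ≡ suc (h + h)) → ∃ (λ h → d ≡ suc (h + h)) → Splitting a b c d
  go (x , refl) (y , refl) (z , refl) (w , refl) = record
    { p₁ = suc x ; q₁ = x ; p₂ = y ; q₂ = suc y ; p₃ = suc z ; q₃ = z ; p₄ = suc w ; q₄ = w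
    ; a≡ = refl ; b≡ = sym (+-suc y y) ; c≡ = refl ; d≡ = refl
    ; first-balanced = sym (+-suc x y) ; second-balanced = +-suc y z
    ; surplus = eq x y z w }
    where
    eq : ∀ x y z w → suc x + (y + (suc z + suc w)) ≡ 2 + (x + (suc y + (z + w)))
    eq = solve-∀
... | yes even-a = go (even⇒half even-a) (even⇒half even-b) (even⇒half even-c) (even⇒half even-d) room
  where
  even-b : 2 ∣ b
  even-b = ∣m+n∣m⇒∣n 2∣ab even-a
  even-c : 2 ∣ c
  even-c = ∣m+n∣m⇒∣n 2∣bc even-b
  even-d : 2 ∣ d
  even-d = ∣m+n∣m⇒∣n 2∣cd even-c
  go : ∃ (λ h → a ≡ h + h) → ∃ (λ h → b ≡ h + h) → ∃ (λ h → c ≡ h + h) → ∃ (λ h → d ≡ h + h) →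
       1 ≤ d ⊎ (1 ≤ a × 1 ≤ b × 1 ≤ c) → Splitting a b c d
  go (x , refl) (y , refl) (z , refl) (suc w , refl) _ = record
    { p₁ = x ; q₁ = x ; p₂ = y ; q₂ = y ; p₃ = z ; q₃ = z ; p₄ = suc (suc w) ; q₄ = w
    ; a≡ = refl ; b≡ = refl ; c≡ = refl ; d≡ = cong suc (+-suc w w)
    ; first-balanced = refl ; second-balanced = refl
    ; surplus = eq x y z w }
    where
    eq : ∀ x y z w → x + (y + (z + suc (suc w))) ≡ 2 + (x + (y + (z + w)))
    eq = solve-∀
  go (suc x , refl) (suc y , refl) (suc z , refl) (zero , refl) (inj₂ _) = record
    { p₁ = suc (suc x) ; q₁ = x ; p₂ = y ; q₂ = suc (suc y) ; p₃ = suc (suc z) ; q₃ = z ; p₄ = 0 ; q₄ = 0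
    ; a≡ = cong suc (+-suc x x) ; b≡ = sym (+-suc y (suc y)) ; c≡ = cong suc (+-suc z z)
    ; d≡ = refl
    ; first-balanced = bal x y ; second-balanced = sym (bal y z)
    ; surplus = eq x y z }
    where
    bal : ∀ x y → suc (suc x) + y ≡ x + suc (suc y)
    bal = solve-∀
    eq : ∀ x y z → suc (suc x) + (y + (suc (suc z) + 0)) ≡ 2 + (x + (suc (suc y) + (z + 0)))
    eq = solve-∀
  go (zero , refl) _ _ (zero , refl) (inj₂ (() , _))
  go (suc x , refl) (zero , refl) _ (zero , refl) (inj₂ (_ , () , _))
  go (suc x , refl) (suc y , refl) (zero , refl) (zero , refl) (inj₂ (_ , _ , ()))

-- These are the alternatives that `splitting` asks for, with the cells cut out of `R`. In the
-- all-even case a nonempty cell has at least two balls, enough to carry a surplus of 2 or -2.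
HasRoom : ∀ {n} (R Q₁ Q₂ : Fin n → Bool) → Set
HasRoom R Q₁ Q₂ =
  1 ≤ count (R ∩ ∁ Q₁ ∩ ∁ Q₂) ⊎
  (1 ≤ count (R ∩ Q₁ ∩ ∁ Q₂) × 1 ≤ count (R ∩ Q₁ ∩ Q₂) × 1 ≤ count (R ∩ ∁ Q₁ ∩ Q₂))

-- Only the cell sizes matter: `splitting` prescribes how many balls of each cell get either color,
-- and `ρ` is glued from one bisection per cell.
surplus-two : ∀ {n} (R Q₁ Q₂ : Fin n → Bool) →
  2 ∣ count (Q₁ ∩ R) → 2 ∣ count (Q₂ ∩ R) → 2 ∣ count R → HasRoom R Q₁ Q₂ →
  ∃ λ ρ → count (Q₁ ∩ R ∩ ρ) ≡ count (Q₁ ∩ R ∩ ∁ ρ) ×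
          count (Q₂ ∩ R ∩ ρ) ≡ count (Q₂ ∩ R ∩ ∁ ρ) ×
          count (R ∩ ρ) ≡ 2 + count (R ∩ ∁ ρ)
surplus-two {n} R Q₁ Q₂ 2∣Q₁ 2∣Q₂ 2∣R room = ρ , eq₁ , eq₂ , eq₃
  where
  A B C D : Fin n → Bool
  A = R ∩ Q₁ ∩ ∁ Q₂
  B = R ∩ Q₁ ∩ Q₂
  C = R ∩ ∁ Q₁ ∩ Q₂
  D = R ∩ ∁ Q₁ ∩ ∁ Q₂
  U : Fin n → Vec Bool 3
  U j = R j ∷ Q₁ j ∷ Q₂ j ∷ []
  fA fB fC fD : Formula 3
  fA r a b = r ∧ a ∧ not b
  fB r a b = r ∧ a ∧ b
  fC r a b = r ∧ not a ∧ b
  fD r a b = r ∧ not a ∧ not b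
  2∣AB : 2 ∣ count A + count B
  2∣AB = subst (2 ∣_) (count-≡ ((λ r a b → a ∧ r) ∷ []) (fA ∷ fB ∷ []) U) 2∣Q₁
  2∣BC : 2 ∣ count B + count C
  2∣BC = subst (2 ∣_) (count-≡ ((λ r a b → b ∧ r) ∷ []) (fB ∷ fC ∷ []) U) 2∣Q₂
  2∣CD : 2 ∣ count C + count D
  2∣CD = ∣m+n∣m⇒∣n (subst (2 ∣_) (trans (count-≡ ((λ r a b → r) ∷ []) (fA ∷ fB ∷ fC ∷ fD ∷ []) U)
    (sym (+-assoc (count A) (count B) _))) 2∣R) 2∣AB
  open Splitting (splitting (count A) (count B) (count C) (count D) 2∣AB 2∣BC 2∣CD room)
  uA = bisect A p₁ q₁ a≡
  uB = bisect B p₂ q₂ b≡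
  uC = bisect C p₃ q₃ c≡
  uD = bisect D p₄ q₄ d≡
  choose : (a b x y z w : Bool) → Bool
  choose a b x y z w = if a then (if b then y else x) else (if b then z else w)
  ρ : Fin n → Bool
  ρ j = choose (Q₁ j) (Q₂ j) (proj₁ uA j) (proj₁ uB j) (proj₁ uC j) (proj₁ uD j)
  V : Fin n → Vec Bool 7
  V j = R j ∷ Q₁ j ∷ Q₂ j ∷ proj₁ uA j ∷ proj₁ uB j ∷ proj₁ uC j ∷ proj₁ uD j ∷ []
  A⁺ B⁺ C⁺ D⁺ A⁻ B⁻ C⁻ D⁻ : Formula 7
  A⁺ r a b x y z w = (r ∧ a ∧ not b) ∧ x
  A⁻ r a b x y z w = (r ∧ a ∧ not b) ∧ not x
  B⁺ r a b x y z w = (r ∧ a ∧ b) ∧ y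
  B⁻ r a b x y z w = (r ∧ a ∧ b) ∧ not y
  C⁺ r a b x y z w = (r ∧ not a ∧ b) ∧ z
  C⁻ r a b x y z w = (r ∧ not a ∧ b) ∧ not z
  D⁺ r a b x y z w = (r ∧ not a ∧ not b) ∧ w
  D⁻ r a b x y z w = (r ∧ not a ∧ not b) ∧ not w
  A⁺≡ : count (A ∩ proj₁ uA) ≡ p₁
  A⁺≡ = proj₁ (proj₂ uA)
  A⁻≡ : count (A ∩ ∁ (proj₁ uA)) ≡ q₁
  A⁻≡ = proj₂ (proj₂ uA)
  B⁺≡ : count (B ∩ proj₁ uB) ≡ p₂
  B⁺≡ = proj₁ (proj₂ uB)
  B⁻≡ : count (B ∩ ∁ (proj₁ uB)) ≡ q₂
  B⁻≡ = proj₂ (proj₂ uB)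
  C⁺≡ : count (C ∩ proj₁ uC) ≡ p₃
  C⁺≡ = proj₁ (proj₂ uC)
  C⁻≡ : count (C ∩ ∁ (proj₁ uC)) ≡ q₃
  C⁻≡ = proj₂ (proj₂ uC)
  D⁺≡ : count (D ∩ proj₁ uD) ≡ p₄
  D⁺≡ = proj₁ (proj₂ uD)
  D⁻≡ : count (D ∩ ∁ (proj₁ uD)) ≡ q₄
  D⁻≡ = proj₂ (proj₂ uD)
  eq₁ : count (Q₁ ∩ R ∩ ρ) ≡ count (Q₁ ∩ R ∩ ∁ ρ)
  eq₁ = trans (count-≡ ((λ r a b x y z w → a ∧ r ∧ choose a b x y z w) ∷ []) (A⁺ ∷ B⁺ ∷ []) V)
    (trans (cong₂ _+_ A⁺≡ B⁺≡)
    (trans first-balanced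
    (trans (cong₂ _+_ (sym A⁻≡) (sym B⁻≡))
    (count-≡ (A⁻ ∷ B⁻ ∷ []) ((λ r a b x y z w → a ∧ r ∧ not (choose a b x y z w)) ∷ []) V))))
  eq₂ : count (Q₂ ∩ R ∩ ρ) ≡ count (Q₂ ∩ R ∩ ∁ ρ)
  eq₂ = trans (count-≡ ((λ r a b x y z w → b ∧ r ∧ choose a b x y z w) ∷ []) (B⁺ ∷ C⁺ ∷ []) V)
    (trans (cong₂ _+_ B⁺≡ C⁺≡)
    (trans second-balanced
    (trans (cong₂ _+_ (sym B⁻≡) (sym C⁻≡))
    (count-≡ (B⁻ ∷ C⁻ ∷ []) ((λ r a b x y z w → b ∧ r ∧ not (choose a b x y z w)) ∷ []) V))))
  eq₃ : count (R ∩ ρ) ≡ 2 + count (R ∩ ∁ ρ)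
  eq₃ = trans (count-≡ ((λ r a b x y z w → r ∧ choose a b x y z w) ∷ []) (A⁺ ∷ B⁺ ∷ C⁺ ∷ D⁺ ∷ []) V)
    (trans (cong₂ _+_ A⁺≡ (cong₂ _+_ B⁺≡ (cong₂ _+_ C⁺≡ D⁺≡)))
    (trans surplus
    (cong (2 +_) (trans
      (cong₂ _+_ (sym A⁻≡) (cong₂ _+_ (sym B⁻≡) (cong₂ _+_ (sym C⁻≡) (sym D⁻≡))))
    (count-≡ (A⁻ ∷ B⁻ ∷ C⁻ ∷ D⁻ ∷ []) ((λ r a b x y z w → r ∧ not (choose a b x y z w)) ∷ []) V)))))

-- Zero-sum signings and the negation of one sign

-- A signing of S, positive on A and negative elsewhere, with sum zero in Q.
ZeroSum : ∀ {n} (S A Q : Fin n → Bool) → Set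
ZeroSum S A Q = count (Q ∩ S ∩ A) ≡ count (Q ∩ S ∩ ∁ A)

-- As `S` has at most `h` balls, neither sign occurs more than `h` times, and the balls outside can
-- fill both colors up to `h`. In the resulting balanced coloring every query is balanced inside
-- `S`, so `flip-balanced` applies.
zeroSum-total : ∀ {n h} {F : List (Query n)} → Successful F → n ≡ h + h → (S A : Fin n → Bool) →
  All (ZeroSum S A) F → count S ≤ h → count (S ∩ A) ≡ count (S ∩ ∁ A)
zeroSum-total {n} {h} {F} success n≡ S A zs S≤h =
  trans (count-≡ ((λ s a u → s ∧ a) ∷ []) ((λ s a u → s ∧ (if s then a else u)) ∷ []) V)
  (trans (flip-balanced success c S (All.map (λ {Q} → inj₁ ∘ local Q) zs) balanced)
  (count-≡ ((λ s a u → s ∧ not (if s then a else u)) ∷ []) ((λ s a u → s ∧ not a) ∷ []) V))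
  where
  p q : ℕ
  p = count (S ∩ A)
  q = count (S ∩ ∁ A)
  W : Fin n → Vec Bool 2
  W j = S j ∷ A j ∷ []
  p≤h : p ≤ h
  p≤h = ≤-trans (count-≤ ((λ s a → s ∧ a) ∷ []) ((λ s a → s) ∷ []) W) S≤h
  q≤h : q ≤ h
  q≤h = ≤-trans (count-≤ ((λ s a → s ∧ not a) ∷ []) ((λ s a → s) ∷ []) W) S≤h
  rest : count (∁ S) ≡ (h ∸ p) + (h ∸ q)
  rest = +-cancelˡ-≡ (p + q) _ _ (trans
    (cong (_+ count (∁ S)) (count-≡ ((λ s a → s ∧ a) ∷ (λ s a → s ∧ not a) ∷ []) ((λ s a → s) ∷ []) W))
    (trans (count-∁ S) (trans n≡ (sym (trans (interchange p q (h ∸ p) (h ∸ q))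
      (cong₂ _+_ (m+[n∸m]≡n p≤h) (m+[n∸m]≡n q≤h)))))))
  half = bisect (∁ S) (h ∸ p) (h ∸ q) rest
  u : Fin n → Bool
  u = proj₁ half
  c : Coloring n
  c j = if S j then A j else u j
  V : Fin n → Vec Bool 3
  V j = S j ∷ A j ∷ u j ∷ []
  local : ∀ Q → ZeroSum S A Q → ZeroSum S c Q
  local Q zs = trans (count-≡ ((λ q s a u → q ∧ s ∧ (if s then a else u)) ∷ [])
      ((λ q s a u → q ∧ s ∧ a) ∷ []) X)
    (trans zs (count-≡ ((λ q s a u → q ∧ s ∧ not a) ∷ [])
        ((λ q s a u → q ∧ s ∧ not (if s then a else u)) ∷ []) X))
    where
    X : Fin n → Vec Bool 4
    X j = Q j ∷ V j
  balanced : count c ≡ count (∁ c)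
  balanced = trans (count-≡ ((λ s a u → if s then a else u) ∷ [])
      ((λ s a u → s ∧ a) ∷ (λ s a u → not s ∧ u) ∷ []) V)
    (trans (trans (cong (p +_) (proj₁ (proj₂ half)))
        (trans (m+[n∸m]≡n p≤h) (sym (trans (cong (q +_) (proj₂ (proj₂ half))) (m+[n∸m]≡n q≤h)))))
    (count-≡ ((λ s a u → s ∧ not a) ∷ (λ s a u → not s ∧ not u) ∷ [])
        ((λ s a u → not (if s then a else u)) ∷ []) V))

count-remove : ∀ {n} (p : Fin n → Bool) x → p x ≡ true → count p ≡ suc (count (p ∩ ∁ ⁅ x ⁆))
count-remove {n} p x px = trans
  (count-≡ ((λ p y → p) ∷ []) ((λ p y → p ∧ y) ∷ (λ p y → p ∧ not y) ∷ []) (λ j → p j ∷ ⁅ x ⁆ j ∷ []))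
  (cong (_+ count (p ∩ ∁ ⁅ x ⁆)) (trans (count-cong only) (count-⁅⁆ x)))
  where
  only : ∀ j → p j ∧ ⁅ x ⁆ j ≡ ⁅ x ⁆ j
  only j with x ≟ j
  ... | yes refl rewrite px = refl
  ... | no _ = Bool.∧-zeroʳ (p j)

-- Negating a zero-sum signing at one ball x gives it the sum -2, and unbalances only the
-- queries containing x; there the coloring ρ outside S is balanced.
negation-impossible : ∀ {n h} {F : List (Query n)} → Successful F → n ≡ h + h → (S A ρ : Fin n → Bool) →
  All (ZeroSum S A) F → count S ≤ h → ∀ x → S x ≡ true → A x ≡ true →
  All (λ Q → Q x ≡ true → count (Q ∩ ∁ S ∩ ρ) ≡ count (Q ∩ ∁ S ∩ ∁ ρ)) F →
  count (∁ S ∩ ρ) ≡ 2 + count (∁ S ∩ ∁ ρ) → ⊥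
negation-impossible {n} {h} {F} success n≡ S A ρ zs S≤h x Sx Ax ρ-bal surplus =
  contradiction
    (trans (flip-balanced success c S (All.zipWith (λ {Q} (z , i) → local Q z i) (zs , ρ-bal)) balanced)
      (trans s⁻≡ (cong suc (trans (sym total) p≡))))
    (m≢1+n+m s⁺ {1})
  where
  total : count (S ∩ A) ≡ count (S ∩ ∁ A)
  total = zeroSum-total success n≡ S A zs S≤h
  mixed : (s a y r : Bool) → Bool
  mixed s a y r = if s then a ∧ not y else r
  c : Coloring n
  c j = mixed (S j) (A j) (⁅ x ⁆ j) (ρ j)
  V : Fin n → Vec Bool 4
  V j = S j ∷ A j ∷ ⁅ x ⁆ j ∷ ρ j ∷ []
  s⁺ s⁻ p q : ℕ
  s⁺ = count (S ∩ c)
  s⁻ = count (S ∩ ∁ c)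
  p  = count (S ∩ A)
  q  = count (S ∩ ∁ A)
  p≡ : p ≡ suc s⁺
  p≡ = trans (count-remove (S ∩ A) x (cong₂ _∧_ Sx Ax))
    (cong suc (count-≡ ((λ s a y r → (s ∧ a) ∧ not y) ∷ []) ((λ s a y r → s ∧ mixed s a y r) ∷ []) V))
  s⁻≡ : s⁻ ≡ suc q
  s⁻≡ = +-cancelˡ-≡ s⁺ _ _ (trans
    (count-≡ ((λ s a y r → s ∧ mixed s a y r) ∷ (λ s a y r → s ∧ not (mixed s a y r)) ∷ [])
             ((λ s a y r → s ∧ a) ∷ (λ s a y r → s ∧ not a) ∷ []) V)
    (trans (cong (_+ q) p≡) (sym (+-suc s⁺ q))))
  -- The surplus of two outside `S` offsets the deficit of two that the negation creates inside.
  balanced : count c ≡ count (∁ c)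
  balanced = trans (count-≡ ((λ s a y r → mixed s a y r) ∷ [])
      ((λ s a y r → s ∧ mixed s a y r) ∷ (λ s a y r → not s ∧ r) ∷ []) V)
    (trans (cong (s⁺ +_) (surplus))
    (trans (move s⁺ (count (∁ S ∩ ∁ ρ)))
    (trans (cong (_+ count (∁ S ∩ ∁ ρ)) (sym (trans s⁻≡ (cong suc (trans (sym total) p≡)))))
    (count-≡ ((λ s a y r → s ∧ not (mixed s a y r)) ∷ (λ s a y r → not s ∧ not r) ∷ [])
        ((λ s a y r → not (mixed s a y r)) ∷ []) V))))
    where
    move : ∀ a b → a + (2 + b) ≡ (2 + a) + b
    move = solve-∀
  drop⁺ : ∀ q s a y r → q ∧ y ≡ false → q ∧ s ∧ mixed s a y r ≡ q ∧ s ∧ a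
  drop⁺ false s     a y     r eq = refl
  drop⁺ true  false a y     r eq = refl
  drop⁺ true  true  a false r eq = Bool.∧-identityʳ a
  drop⁻ : ∀ q s a y r → q ∧ y ≡ false → q ∧ s ∧ not (mixed s a y r) ≡ q ∧ s ∧ not a
  drop⁻ false s     a y     r eq = refl
  drop⁻ true  false a y     r eq = refl
  drop⁻ true  true  a false r eq = cong not (Bool.∧-identityʳ a)
  local : ∀ Q → ZeroSum S A Q → (Q x ≡ true → count (Q ∩ ∁ S ∩ ρ) ≡ count (Q ∩ ∁ S ∩ ∁ ρ)) →
          count (Q ∩ S ∩ c) ≡ count (Q ∩ S ∩ ∁ c) ⊎ count (Q ∩ ∁ S ∩ c) ≡ count (Q ∩ ∁ S ∩ ∁ c)
  local Q zs bal with Q x Bool.≟ true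
  ... | yes Qx = inj₂ (trans
    (count-≡ ((λ q s a y r → q ∧ not s ∧ mixed s a y r) ∷ []) ((λ q s a y r → q ∧ not s ∧ r) ∷ []) W)
    (trans (bal Qx)
    (count-≡ ((λ q s a y r → q ∧ not s ∧ not r) ∷ [])
        ((λ q s a y r → q ∧ not s ∧ not (mixed s a y r)) ∷ []) W)))
    where
    W : Fin n → Vec Bool 5
    W j = Q j ∷ V j
  ... | no ¬Qx = inj₁ (trans
    (count-cong (λ j → drop⁺ (Q j) (S j) (A j) (⁅ x ⁆ j) (ρ j) (apart j)))
    (trans zs
    (sym (count-cong (λ j → drop⁻ (Q j) (S j) (A j) (⁅ x ⁆ j) (ρ j) (apart j))))))
    where
    apart : ∀ j → Q j ∧ ⁅ x ⁆ j ≡ false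
    apart j with x ≟ j
    ... | yes refl = trans (Bool.∧-identityʳ (Q x)) (Bool.¬-not ¬Qx)
    ... | no _     = Bool.∧-zeroʳ (Q j)



2∣m+m : ∀ m → 2 ∣ m + m
2∣m+m m = divides m (trans (cong (m +_) (sym (+-identityʳ m))) (*-comm 2 m))

outside-even : ∀ {n} (S A Q : Fin n → Bool) → 2 ∣ count Q → ZeroSum S A Q → 2 ∣ count (Q ∩ ∁ S)
outside-even S A Q 2∣Q zs = ∣m+n∣m⇒∣n (subst (2 ∣_) split 2∣Q)
  (subst (λ m → 2 ∣ count (Q ∩ S ∩ A) + m) zs (2∣m+m (count (Q ∩ S ∩ A))))
  where
  split : count Q ≡ count (Q ∩ S ∩ A) + count (Q ∩ S ∩ ∁ A) + count (Q ∩ ∁ S)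
  split = trans
    (count-≡ ((λ q s a → q) ∷ [])
        ((λ q s a → q ∧ s ∧ a) ∷ (λ q s a → q ∧ s ∧ not a) ∷ (λ q s a → q ∧ not s) ∷ [])
             (λ j → Q j ∷ S j ∷ A j ∷ []))
    (sym (+-assoc (count (Q ∩ S ∩ A)) _ _))

-- Here `ρ` is supplied by `surplus-two`. The sets `Q₁`, `Q₂` need not belong to the family, which
-- allows empty sets for a ball in fewer queries.
zeroSum-impossible : ∀ {n h} {F : List (Query n)} → Successful F → n ≡ h + h → (S A : Fin n → Bool) →
  All (ZeroSum S A) F → count S ≤ h → ∀ x → S x ≡ true → A x ≡ true → ∀ Q₁ Q₂ →
  All (λ Q → Q x ≡ true → Q ≡ Q₁ ⊎ Q ≡ Q₂) F →
  2 ∣ count Q₁ → ZeroSum S A Q₁ → 2 ∣ count Q₂ → ZeroSum S A Q₂ → HasRoom (∁ S) Q₁ Q₂ → ⊥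
zeroSum-impossible {n} {h} success n≡ S A zs S≤h x Sx Ax Q₁ Q₂ cover 2∣Q₁ zs₁ 2∣Q₂ zs₂ room =
  conclude (surplus-two (∁ S) Q₁ Q₂ (outside-even S A Q₁ 2∣Q₁ zs₁) (outside-even S A Q₂ 2∣Q₂ zs₂) all-even room)
  where
  -- The whole set acts as one more even query: the signing has sum zero on it by `zeroSum-total`.
  all-even : 2 ∣ count (∁ ∅ ∩ ∁ S)
  all-even = outside-even S A (∁ ∅) (subst (2 ∣_) (sym (trans (count-all n) n≡)) (2∣m+m h))
    (zeroSum-total success n≡ S A zs S≤h)
  conclude : (∃ λ ρ → count (Q₁ ∩ ∁ S ∩ ρ) ≡ count (Q₁ ∩ ∁ S ∩ ∁ ρ) ×
                      count (Q₂ ∩ ∁ S ∩ ρ) ≡ count (Q₂ ∩ ∁ S ∩ ∁ ρ) ×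
                      count (∁ S ∩ ρ) ≡ 2 + count (∁ S ∩ ∁ ρ)) → ⊥
  conclude (ρ , bal₁ , bal₂ , surplus) =
    negation-impossible success n≡ S A ρ zs S≤h x Sx Ax (All.map (λ i Qx → balanced (i Qx)) cover) surplus
    where
    balanced : ∀ {Q} → Q ≡ Q₁ ⊎ Q ≡ Q₂ → count (Q ∩ ∁ S ∩ ρ) ≡ count (Q ∩ ∁ S ∩ ∁ ρ)
    balanced (inj₁ refl) = bal₁
    balanced (inj₂ refl) = bal₂

-- Pigeonhole principle for several functions at once

length-filter-split : ∀ {A : Set} {P : A → Set} (P? : ∀ x → Dec (P x)) (xs : List A) →
  length (filter P? xs) + length (filter (¬? ∘ P?) xs) ≡ length xs
length-filter-split P? [] = refl
length-filter-split P? (x ∷ xs) with P? x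
... | yes _ = cong suc (length-filter-split P? xs)
... | no  _ = trans (+-suc _ _) (cong suc (length-filter-split P? xs))

-- Induction on the largest value: either its fiber has more than `m` elements, or discarding the
-- fiber costs at most `m` elements and one of the `suc d` values.
pigeonhole : ∀ {A : Set} (f : A → ℕ) d m (xs : List A) → (∀ {x} → x ∈ xs → f x ≤ d) →
  m * suc d < length xs → Unique xs →
  ∃ λ ys → m < length ys × Unique ys × (∀ {y} → y ∈ ys → y ∈ xs) × (∀ {y z} → y ∈ ys → z ∈ ys → f y ≡ f z)
pigeonhole f zero m xs f≤ m< unique =
  xs , subst (_< length xs) (*-identityʳ m) m< , unique , (λ y∈ → y∈) ,
  λ y∈ z∈ → trans (n≤0⇒n≡0 (f≤ y∈)) (sym (n≤0⇒n≡0 (f≤ z∈)))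
pigeonhole f (suc d) m xs f≤ m< unique with m <? length (filter (λ x → f x ℕ.≟ suc d) xs)
... | yes m<top =
  filter top? xs , m<top , Unique.filter⁺ top? unique , (λ y∈ → proj₁ (∈-filter⁻ top? y∈)) ,
  λ y∈ z∈ → trans (proj₂ (∈-filter⁻ top? {xs = xs} y∈)) (sym (proj₂ (∈-filter⁻ top? {xs = xs} z∈)))
  where
  top? = λ x → f x ℕ.≟ suc d
... | no ¬m<top with pigeonhole f d m rest rest≤ m<rest (Unique.filter⁺ (¬? ∘ top?) unique)
  where
  top? = λ x → f x ℕ.≟ suc d
  rest = filter (¬? ∘ top?) xs
  rest≤ : ∀ {x} → x ∈ rest → f x ≤ d
  rest≤ x∈ with ∈-filter⁻ (¬? ∘ top?) {xs = xs} x∈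
  ... | x∈xs , fx≢ = s≤s⁻¹ (≤∧≢⇒< (f≤ x∈xs) fx≢)
  m<rest : m * suc d < length rest
  m<rest = +-cancelˡ-< m _ _ (subst (_< m + length rest) (*-suc m (suc d))
    (<-≤-trans m< (≤-trans (≤-reflexive (sym (length-filter-split top? xs)))
        (+-monoˡ-≤ (length rest) (≮⇒≥ ¬m<top)))))
... | ys , m<ys , unique-ys , ys⊆ , const =
  ys , m<ys , unique-ys , (λ y∈ → proj₁ (∈-filter⁻ (¬? ∘ (λ x → f x ℕ.≟ suc d)) (ys⊆ y∈))) , const

-- Each function in turn divides the guaranteed length by the number of its values, whence the
-- product.
pigeonholes : ∀ {A B : Set} (f : B → A → ℕ) (d : B → ℕ) (bs : List B) m (xs : List A) →
  (∀ b {x} → x ∈ xs → f b x ≤ d b) → m * product (map (suc ∘ d) bs) < length xs → Unique xs →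
  ∃ λ ys → m < length ys × Unique ys × (∀ {y} → y ∈ ys → y ∈ xs) ×
           All (λ b → ∀ {y z} → y ∈ ys → z ∈ ys → f b y ≡ f b z) bs
pigeonholes f d [] m xs f≤ m< unique =
  xs , subst (_< length xs) (*-identityʳ m) m< , unique , (λ y∈ → y∈) , []
pigeonholes f d (b ∷ bs) m xs f≤ m< unique
  with pigeonhole (f b) (d b) (m * product (map (suc ∘ d) bs)) xs (f≤ b)
         (subst (_< length xs) (trans (cong (m *_) (*-comm (suc (d b)) _)) (sym (*-assoc m _ _))) m<) unique
... | ys , m<ys , unique-ys , ys⊆ , const
  with pigeonholes f d bs m ys (λ b y∈ → f≤ b (ys⊆ y∈)) m<ys unique-ys
... | zs , m<zs , unique-zs , zs⊆ , consts =
  zs , m<zs , unique-zs , ys⊆ ∘ zs⊆ , (λ y∈ z∈ → const (zs⊆ y∈) (zs⊆ z∈)) ∷ consts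

-- Double counting and balls in at most two queries

sum-0 : ∀ {A : Set} (as : List A) → sum (map (λ _ → 0) as) ≡ 0
sum-0 []       = refl
sum-0 (a ∷ as) = sum-0 as

sum-+ : ∀ {A : Set} (f g : A → ℕ) as → sum (map (λ a → f a + g a) as) ≡ sum (map f as) + sum (map g as)
sum-+ f g []       = refl
sum-+ f g (a ∷ as) rewrite sum-+ f g as = interchange (f a) (g a) _ _

sum-≤ : ∀ {A : Set} {f g : A → ℕ} → (∀ a → f a ≤ g a) → ∀ as → sum (map f as) ≤ sum (map g as)
sum-≤ f≤g []       = z≤n
sum-≤ f≤g (a ∷ as) = +-mono-≤ (f≤g a) (sum-≤ f≤g as)

sum-const : ∀ {A : Set} {f : A → ℕ} {k} {as : List A} → All (λ a → f a ≡ k) as → sum (map f as) ≡ length as * k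
sum-const []         = refl
sum-const (eq ∷ eqs) = cong₂ _+_ eq (sum-const eqs)

-- The incidence `G` is kept apart from the index list so that inductions over the balls can
-- restrict it to `λ a → G a ∘ suc` while the list stays the same.
degree : ∀ {A : Set} {n} → (A → Fin n → Bool) → List A → Fin n → ℕ
degree G as x = sum (map (λ a → 𝟙 (G a x)) as)

double-count-≤ : ∀ {A : Set} {n} (G : A → Fin n → Bool) (as : List A) d (E : Fin n → Bool) →
  (∀ x → E x ≡ true → degree G as x ≤ d) → sum (map (λ a → count (E ∩ G a)) as) ≤ d * count E
double-count-≤ {n = zero}  G as d E deg = ≤-trans (≤-reflexive (sum-0 as)) z≤n
double-count-≤ {n = suc n} G as d E deg = begin
  sum (map (λ a → count (E ∩ G a)) as)
    ≡⟨ sum-+ (λ a → 𝟙 (E zero ∧ G a zero)) (λ a → count ((E ∩ G a) ∘ suc)) as ⟩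
  sum (map (λ a → 𝟙 (E zero ∧ G a zero)) as) + sum (map (λ a → count ((E ∩ G a) ∘ suc)) as)
    ≤⟨ +-mono-≤ (first (E zero) (deg zero)) (double-count-≤ (λ a → G a ∘ suc) as d (E ∘ suc) (deg ∘ suc)) ⟩
  d * 𝟙 (E zero) + d * count (E ∘ suc)
    ≡⟨ *-distribˡ-+ d (𝟙 (E zero)) (count (E ∘ suc)) ⟨
  d * count E ∎
  where
  open ≤-Reasoning
  first : ∀ e → (e ≡ true → degree G as zero ≤ d) → sum (map (λ a → 𝟙 (e ∧ G a zero)) as) ≤ d * 𝟙 e
  first true  deg = ≤-trans (deg refl) (≤-reflexive (sym (*-identityʳ d)))
  first false deg = ≤-trans (≤-reflexive (sum-0 as)) z≤n

double-count-≥ : ∀ {A : Set} {n} (G : A → Fin n → Bool) (as : List A) d (E : Fin n → Bool) →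
  (∀ x → E x ≡ true → d ≤ degree G as x) → d * count E ≤ sum (map (λ a → count (E ∩ G a)) as)
double-count-≥ {n = zero}  G as d E deg = ≤-trans (≤-reflexive (*-zeroʳ d)) z≤n
double-count-≥ {n = suc n} G as d E deg = begin
  d * count E
    ≡⟨ *-distribˡ-+ d (𝟙 (E zero)) (count (E ∘ suc)) ⟩
  d * 𝟙 (E zero) + d * count (E ∘ suc)
    ≤⟨ +-mono-≤ (first (E zero) (deg zero)) (double-count-≥ (λ a → G a ∘ suc) as d (E ∘ suc) (deg ∘ suc)) ⟩
  sum (map (λ a → 𝟙 (E zero ∧ G a zero)) as) + sum (map (λ a → count ((E ∩ G a) ∘ suc)) as)
    ≡⟨ sum-+ (λ a → 𝟙 (E zero ∧ G a zero)) (λ a → count ((E ∩ G a) ∘ suc)) as ⟨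
  sum (map (λ a → count (E ∩ G a)) as) ∎
  where
  open ≤-Reasoning
  first : ∀ e → (e ≡ true → d ≤ degree G as zero) → d * 𝟙 e ≤ sum (map (λ a → 𝟙 (e ∧ G a zero)) as)
  first true  deg = ≤-trans (≤-reflexive (*-identityʳ d)) (deg refl)
  first false deg = ≤-trans (≤-reflexive (*-zeroʳ d)) z≤n

deg : ∀ {n} → List (Query n) → Fin n → ℕ
deg = degree (λ Q → Q)

low high : ∀ {n} → List (Query n) → Fin n → Bool
low F x = deg F x ≤ᵇ 2
high F = ∁ (low F)

low-deg : ∀ {n} (F : List (Query n)) x → low F x ≡ true → deg F x ≤ 2
low-deg F x eq = ≤ᵇ⇒≤ _ 2 (Equivalence.from Bool.T-≡ eq)

high-deg : ∀ {n} (F : List (Query n)) x → high F x ≡ true → 3 ≤ deg F x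
high-deg F x eq = ≰⇒> λ d≤2 → contradiction
  (trans (sym (Equivalence.to Bool.T-≡ (≤⇒≤ᵇ d≤2))) (Bool.not-injective eq)) λ ()

-- The family has `length F * k` incidences, and each ball outside `low F` accounts for at least
-- three of them.
low-count : ∀ {n k} (F : List (Query n)) → IsKFamily k F → 3 * n ≤ 3 * count (low F) + length F * k
low-count {n} {k} F family = begin
  3 * n                                     ≡⟨ cong (3 *_) (count-∁ (low F)) ⟨
  3 * (count (low F) + count (high F))      ≡⟨ *-distribˡ-+ 3 (count (low F)) (count (high F)) ⟩
  3 * count (low F) + 3 * count (high F)    ≤⟨ +-monoʳ-≤ (3 * count (low F)) incidences ⟩
  3 * count (low F) + length F * k          ∎
  where
  open ≤-Reasoning
  incidences : 3 * count (high F) ≤ length F * k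
  incidences = begin
    3 * count (high F)                       ≤⟨ double-count-≥ (λ Q → Q) F 3 (high F) (high-deg F) ⟩
    sum (map (λ Q → count (high F ∩ Q)) F)   ≤⟨ sum-≤ (λ Q → count-≤ ((λ e q → e ∧ q) ∷ []) ((λ e q → q) ∷ [])
                                                            (λ j → high F j ∷ Q j ∷ [])) F ⟩
    sum (map count F)                        ≡⟨ sum-const family ⟩
    length F * k                             ∎

incident : ∀ {n} → List (Query n) → Fin n → List (Query n)
incident F x = filter (λ Q → Q x Bool.≟ true) F

length-incident : ∀ {n} (F : List (Query n)) x → length (incident F x) ≡ deg F x
length-incident []      x = refl
length-incident (Q ∷ F) x with Q x
... | true  = cong suc (length-incident F x)
... | false = length-incident F x

-- A ball in no query gets two empty sets.
two-queries : ∀ {n} (F : List (Query n)) x → deg F x ≤ 2 → ∃₂ λ Q₁ Q₂ →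
  All (λ Q → Q x ≡ true → Q ≡ Q₁ ⊎ Q ≡ Q₂) F ×
  ((Q₁ ≡ ∅ × Q₂ ≡ ∅) ⊎ (Q₁ ∈ F × Q₁ x ≡ true) × (Q₂ ∈ F × Q₂ x ≡ true))
two-queries F x deg≤2 with incident F x in eq
  | subst (_≤ 2) (sym (length-incident F x)) deg≤2
... | [] | _ = ∅ , ∅ , All.tabulate (λ Q∈ Qx → case found Q∈ Qx of λ ()) ,
  inj₁ (refl , refl)
  where
  found : ∀ {Q} → Q ∈ F → Q x ≡ true → Q ∈ []
  found Q∈ Qx = subst (_ ∈_) eq (∈-filter⁺ (λ Q → Q x Bool.≟ true) Q∈ Qx)
... | Q₁ ∷ [] | _ = Q₁ , Q₁ , All.tabulate (λ Q∈ Qx → case found Q∈ Qx of λ { (here refl) → inj₁ refl }) ,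
  inj₂ (member , member)
  where
  found : ∀ {Q} → Q ∈ F → Q x ≡ true → Q ∈ Q₁ ∷ []
  found Q∈ Qx = subst (_ ∈_) eq (∈-filter⁺ (λ Q → Q x Bool.≟ true) Q∈ Qx)
  member : Q₁ ∈ F × Q₁ x ≡ true
  member = ∈-filter⁻ (λ Q → Q x Bool.≟ true) (subst (Q₁ ∈_) (sym eq) (here refl))
... | Q₁ ∷ Q₂ ∷ [] | _ = Q₁ , Q₂ ,
  All.tabulate (λ Q∈ Qx → case found Q∈ Qx of λ { (here refl) → inj₁ refl ; (there (here refl)) → inj₂ refl }) ,
  inj₂ (member (here refl) , member (there (here refl)))
  where
  found : ∀ {Q} → Q ∈ F → Q x ≡ true → Q ∈ Q₁ ∷ Q₂ ∷ []
  found Q∈ Qx = subst (_ ∈_) eq (∈-filter⁺ (λ Q → Q x Bool.≟ true) Q∈ Qx)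
  member : ∀ {Q} → Q ∈ Q₁ ∷ Q₂ ∷ [] → Q ∈ F × Q x ≡ true
  member Q∈ = ∈-filter⁻ (λ Q → Q x Bool.≟ true) (subst (_ ∈_) (sym eq) Q∈)
... | _ ∷ _ ∷ _ ∷ _ | s≤s (s≤s ())

-- Two subsets meeting every query equally

elements : ∀ {n} → (Fin n → Bool) → List (Fin n)
elements E = filter (λ x → E x Bool.≟ true) (allFin _)

length-elements : ∀ {n} (E : Fin n → Bool) → length (elements E) ≡ count E
length-elements {n} E = go (λ x → x)
  where
  go : ∀ {m} (f : Fin m → Fin n) → length (filter (λ x → E x Bool.≟ true) (tabulate f)) ≡ count (E ∘ f)
  go {zero}  f = refl
  go {suc m} f with E (f zero)
  ... | true  = cong suc (go (f ∘ suc))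
  ... | false = go (f ∘ suc)

-- Subsets are vectors here because unequal vectors differ at some index, which `differ` finds;
-- inequality of functions yields no such index constructively.
subsets : ∀ {n} → (Fin n → Bool) → List (Vec Bool n)
subsets {zero}  E = [] ∷ []
subsets {suc n} E with E zero
... | true  = map (true ∷_) (subsets (E ∘ suc)) ++ map (false ∷_) (subsets (E ∘ suc))
... | false = map (false ∷_) (subsets (E ∘ suc))

length-subsets : ∀ {n} (E : Fin n → Bool) → length (subsets E) ≡ 2 ^ count E
length-subsets {zero}  E = refl
length-subsets {suc n} E with E zero
... | false = trans (length-map (false ∷_) (subsets (E ∘ suc))) (length-subsets (E ∘ suc))
... | true  = trans (length-++ (map (true ∷_) (subsets (E ∘ suc))))
  (cong₂ _+_ (trans (length-map (true ∷_) (subsets (E ∘ suc))) (length-subsets (E ∘ suc)))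
    (trans (trans (length-map (false ∷_) (subsets (E ∘ suc))) (length-subsets (E ∘ suc)))
        (sym (+-identityʳ _))))

unique-subsets : ∀ {n} (E : Fin n → Bool) → Unique (subsets E)
unique-subsets {zero}  E = [] ∷ []
unique-subsets {suc n} E with E zero
... | false = Unique.map⁺ (cong Vec.tail) (unique-subsets (E ∘ suc))
... | true  = Unique.++⁺ (Unique.map⁺ (cong Vec.tail) (unique-subsets (E ∘ suc)))
                         (Unique.map⁺ (cong Vec.tail) (unique-subsets (E ∘ suc))) disjoint
  where
  disjoint : ∀ {v} → ¬ (v ∈ map (true ∷_) (subsets (E ∘ suc)) × v ∈ map (false ∷_) (subsets (E ∘ suc)))
  disjoint (t , f) with ∈-map⁻ (true ∷_) t | ∈-map⁻ (false ∷_) f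
  ... | _ , _ , refl | _ , _ , ()

subsets-⊆ : ∀ {n} (E : Fin n → Bool) {v} → v ∈ subsets E → ∀ x → lookup v x ≡ true → E x ≡ true
subsets-⊆ {suc n} E v∈ x vx with E zero in E0
subsets-⊆ {suc n} E v∈ x vx | false with ∈-map⁻ (false ∷_) v∈
subsets-⊆ {suc n} E v∈ (suc x) vx | false | _ , w∈ , refl = subsets-⊆ (E ∘ suc) w∈ x vx
subsets-⊆ {suc n} E v∈ zero    vx | true = E0
subsets-⊆ {suc n} E v∈ (suc x) vx | true with ∈-++⁻ (map (true ∷_) (subsets (E ∘ suc))) v∈
... | inj₁ t with ∈-map⁻ (true ∷_) t
...   | _ , w∈ , refl = subsets-⊆ (E ∘ suc) w∈ x vx
subsets-⊆ {suc n} E v∈ (suc x) vx | true | inj₂ f with ∈-map⁻ (false ∷_) f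
...   | _ , w∈ , refl = subsets-⊆ (E ∘ suc) w∈ x vx

differ : ∀ {n} (v w : Vec Bool n) → v ≢ w → ∃ λ x → lookup v x ≢ lookup w x
differ []      []      v≢w = contradiction refl v≢w
differ (a ∷ v) (b ∷ w) v≢w with a Bool.≟ b
... | no a≢b = zero , a≢b
... | yes refl with differ v w (v≢w ∘ cong (a ∷_))
...   | x , ≢ = suc x , ≢

-- Equality holds at `d = 3`. From there on a step doubles the right side and multiplies the left
-- side by at most (5/4)^3 < 2; the smaller cases are computed.
cube-bound : ∀ d → suc d ^ 3 ≤ 2 ^ (3 + d)
cube-bound 0 = ≤ᵇ⇒≤ 1 8 _
cube-bound 1 = ≤ᵇ⇒≤ 8 16 _
cube-bound 2 = ≤ᵇ⇒≤ 27 32 _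
cube-bound (suc (suc (suc d))) = large d
  where
  open ≤-Reasoning
  expand : ∀ d → (5 + d) * ((5 + d) * ((5 + d) * 1)) + (d * d * d + 9 * (d * d) + 21 * d + 3)
                   ≡ 2 * ((4 + d) * ((4 + d) * ((4 + d) * 1)))
  expand = solve-∀
  large : ∀ d → (4 + d) ^ 3 ≤ 2 ^ (6 + d)
  large zero    = ≤ᵇ⇒≤ 64 64 _
  large (suc d) = begin
    (5 + d) ^ 3                                           ≤⟨ m≤m+n _ (d * d * d + 9 * (d * d) + 21 * d + 3) ⟩
    (5 + d) ^ 3 + (d * d * d + 9 * (d * d) + 21 * d + 3)  ≡⟨ expand d ⟩
    2 * (4 + d) ^ 3                                       ≤⟨ *-monoʳ-≤ 2 (large d) ⟩
    2 ^ (7 + d)                                           ∎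

product-cube-bound : ∀ {A : Set} (d : A → ℕ) as →
    product (map (suc ∘ d) as) ^ 3 ≤ 2 ^ (3 * length as + sum (map d as))
product-cube-bound d []       = ≤-refl
product-cube-bound d (a ∷ as) = begin
  (suc (d a) * P) ^ 3                        ≡⟨ cubes (suc (d a)) P ⟩
  suc (d a) ^ 3 * P ^ 3                      ≤⟨ *-mono-≤ (cube-bound (d a)) (product-cube-bound d as) ⟩
  2 ^ (3 + d a) * 2 ^ (3 * length as + s)      ≡⟨ ^-distribˡ-+-* 2 (3 + d a) (3 * length as + s) ⟨
  2 ^ (3 + d a + (3 * length as + s))        ≡⟨ cong (2 ^_) (rearrange (d a) (length as) s) ⟩
  2 ^ (3 * suc (length as) + (d a + s))      ∎
  where
  open ≤-Reasoning
  P = product (map (suc ∘ d) as)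
  s = sum (map d as)
  cubes : ∀ x y → (x * y) * ((x * y) * ((x * y) * 1)) ≡ x * (x * (x * 1)) * (y * (y * (y * 1)))
  cubes = solve-∀
  rearrange : ∀ a l s → 3 + a + (3 * l + s) ≡ 3 * suc l + (a + s)
  rearrange = solve-∀

count-mono : ∀ {n} {p q : Fin n → Bool} → (∀ j → p j ≡ true → q j ≡ true) → count p ≤ count q
count-mono {zero}  p⊆q = z≤n
count-mono {suc n} {p} {q} p⊆q = +-mono-≤ (first (p zero) (q zero) (p⊆q zero)) (count-mono (p⊆q ∘ suc))
  where
  first : ∀ a b → (a ≡ true → b ≡ true) → 𝟙 a ≤ 𝟙 b
  first false b a⊆b = z≤n
  first true  b a⊆b rewrite a⊆b refl = ≤-refl

-- The comparison is between cubes, to which `product-cube-bound` applies; by `size`, the exponent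
-- `3 * q + 2 * e` is one less than `3 * e`.
product<subsets : ∀ {n} (F : List (Query n)) (E : Fin n → Bool) → count E ≡ suc (3 * length F) →
  (∀ x → E x ≡ true → deg F x ≤ 2) → product (map (λ Q → suc (count (E ∩ Q))) F) < 2 ^ count E
product<subsets F E size low = ≰⇒> λ 2^≤P → <-irrefl refl (begin-strict
  2 ^ (3 * q + 2 * e)     <⟨ ^-monoʳ-< 2 (s≤s (s≤s z≤n)) (≤-reflexive (cong (_+ 2 * e) (sym size))) ⟩
  2 ^ (3 * e)             ≡⟨ cong (2 ^_) (*-comm 3 e) ⟩
  2 ^ (e * 3)             ≡⟨ ^-*-assoc 2 e 3 ⟨
  (2 ^ e) ^ 3             ≤⟨ ^-monoˡ-≤ 3 2^≤P ⟩
  P ^ 3                   ≤⟨ product-cube-bound (λ Q → count (E ∩ Q)) F ⟩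
  2 ^ (3 * q + sum (map (λ Q → count (E ∩ Q)) F))
                          ≤⟨ ^-monoʳ-≤ 2 (+-monoʳ-≤ (3 * q) (double-count-≤ (λ Q → Q) F 2 E low)) ⟩
  2 ^ (3 * q + 2 * e)     ∎)
  where
  open ≤-Reasoning
  q = length F
  e = count E
  P = product (map (λ Q → suc (count (E ∩ Q))) F)

-- More balls of degree at most 2 than three times the number of queries: the 2 ^ (count E)
-- subsets of E then outnumber the possible vectors of intersection sizes.
equal-subsets : ∀ {n} (F : List (Query n)) (E : Fin n → Bool) → count E ≡ suc (3 * length F) →
  (∀ x → E x ≡ true → deg F x ≤ 2) →
  ∃₂ λ (A B : Fin n → Bool) → (∀ x → A x ≡ true → E x ≡ true) × (∀ x → B x ≡ true → E x ≡ true) ×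
    All (λ Q → count (Q ∩ A) ≡ count (Q ∩ B)) F × ∃ λ x → A x ≡ true × B x ≡ false
equal-subsets F E size low
  with pigeonholes (λ Q v → count (Q ∩ lookup v)) (λ Q → count (E ∩ Q)) F 1 (subsets E) bounded
         (subst₂ _<_ (sym (*-identityˡ _)) (sym (length-subsets E)) (product<subsets F E size low))
         (unique-subsets E)
  where
  bounded : ∀ Q {v} → v ∈ subsets E → count (Q ∩ lookup v) ≤ count (E ∩ Q)
  bounded Q {v} v∈ = count-mono λ j Qv → cong₂ _∧_
    (subsets-⊆ E v∈ j (Bool.∧-conicalʳ (Q j) _ Qv)) (Bool.∧-conicalˡ (Q j) _ Qv)
... | _ ∷ [] , s≤s () , _
... | v ∷ w ∷ _ , _ , ((v≢w ∷ _) ∷ _) , ⊆subsets , same with differ v w v≢w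
-- The two subsets are ordered so that the ball where they differ lies in the first, hence carries a
-- positive sign.
...   | x , vx≢wx with lookup v x Bool.≟ true
...     | yes vx = lookup v , lookup w ,
    subsets-⊆ E (⊆subsets (here refl)) , subsets-⊆ E (⊆subsets (there (here refl))) ,
            All.map (λ eq → eq (here refl) (there (here refl))) same ,
            x , vx , Bool.¬-not (λ wx → vx≢wx (trans vx (sym wx)))
...     | no ¬vx = lookup w , lookup v ,
    subsets-⊆ E (⊆subsets (there (here refl))) , subsets-⊆ E (⊆subsets (here refl)) ,
            All.map (λ eq → eq (there (here refl)) (here refl)) same ,
            x , trans (Bool.¬-not (vx≢wx ∘ sym)) (cong not (Bool.¬-not ¬vx)) , Bool.¬-not ¬vx

-- The balls common to `A` and `B` cancel, leaving those only in `A`, with sign +, against those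
-- only in `B`, with sign -.
difference-zeroSum : ∀ {n} (A B Q : Fin n → Bool) → count (Q ∩ A) ≡ count (Q ∩ B) →
    ZeroSum (λ j → A j xor B j) A Q
difference-zeroSum A B Q eq = +-cancelʳ-≡ (count (Q ∩ A ∩ B)) _ _ (trans
  (count-≡ ((λ q a b → q ∧ (a xor b) ∧ a) ∷ (λ q a b → q ∧ a ∧ b) ∷ []) ((λ q a b → q ∧ a) ∷ []) V)
  (trans eq
  (count-≡ ((λ q a b → q ∧ b) ∷ []) ((λ q a b → q ∧ (a xor b) ∧ not a) ∷ (λ q a b → q ∧ a ∧ b) ∷ []) V)))
  where
  V = λ j → Q j ∷ A j ∷ B j ∷ []

-- Contradictions for many balls, for few queries and for queries of full size

large-impossible : ∀ {n k h} {F : List (Query n)} → Successful F → IsKFamily k F → 2 ∣ k → n ≡ h + h →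
  suc (3 * length F) ≤ count (low F) → suc (3 * length F) ≤ h → k + k + suc (3 * length F) < n → ⊥
large-impossible {n} {k} {h} {F} success family 2∣k n≡ many small room
  with bisect (low F) (suc (3 * length F)) _ (sym (m+[n∸m]≡n many))
... | u , size , _ with equal-subsets F (low F ∩ u) size (λ x Ex → low-deg F x (Bool.∧-conicalˡ _ _ Ex))
... | A , B , A⊆E , B⊆E , same , x , Ax , Bx
  with two-queries F x (low-deg F x (Bool.∧-conicalˡ _ _ (A⊆E x Ax)))
... | Q₁ , Q₂ , cover , kind =
  zeroSum-impossible success n≡ S A zs (≤-trans S≤ small) x (cong₂ _xor_ Ax Bx) Ax Q₁ Q₂ cover
    (even Q₁ (proj₁ members)) (zero-sum Q₁ (proj₁ members))
    (even Q₂ (proj₂ members)) (zero-sum Q₂ (proj₂ members)) (inj₁ free)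
  where
  S : Fin n → Bool
  S j = A j xor B j
  zs : All (ZeroSum S A) F
  zs = All.map (λ {Q} → difference-zeroSum A B Q) same
  members : (Q₁ ≡ ∅ ⊎ Q₁ ∈ F) × (Q₂ ≡ ∅ ⊎ Q₂ ∈ F)
  members = case kind of λ where
    (inj₁ (e₁ , e₂))             → inj₁ e₁ , inj₁ e₂
    (inj₂ ((Q₁∈ , _) , (Q₂∈ , _))) → inj₂ Q₁∈ , inj₂ Q₂∈
  even : ∀ Q → Q ≡ ∅ ⊎ Q ∈ F → 2 ∣ count Q
  even Q (inj₁ refl) = subst (2 ∣_) (sym (count-∅ n)) (2 ∣0)
  even Q (inj₂ Q∈)   = subst (2 ∣_) (sym (All.lookup family Q∈)) 2∣k
  zero-sum : ∀ Q → Q ≡ ∅ ⊎ Q ∈ F → ZeroSum S A Q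
  zero-sum Q (inj₁ refl) = refl
  zero-sum Q (inj₂ Q∈)   = All.lookup zs Q∈
  bounded : ∀ Q → Q ≡ ∅ ⊎ Q ∈ F → count Q ≤ k
  bounded Q (inj₁ refl) = ≤-trans (≤-reflexive (count-∅ n)) z≤n
  bounded Q (inj₂ Q∈)   = ≤-reflexive (All.lookup family Q∈)
  S⊆E : ∀ j → S j ≡ true → (low F ∩ u) j ≡ true
  S⊆E j Sj with A j in Aj
  ... | true  = A⊆E j Aj
  ... | false = B⊆E j Sj
  S≤ : count S ≤ suc (3 * length F)
  S≤ = ≤-trans (count-mono S⊆E) (≤-reflexive size)
  D = ∁ S ∩ ∁ Q₁ ∩ ∁ Q₂
  -- Two queries and `S` together hold at most 2k + 3 |F| + 1 balls, fewer than `n`.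
  free : 1 ≤ count D
  free = +-cancelʳ-≤ (k + k + suc (3 * length F)) 1 (count D) (begin
    1 + (k + k + suc (3 * length F))            ≤⟨ room ⟩
    n                                           ≡⟨ count-all n ⟨
    count {n} (∁ ∅)                             ≤⟨ count-≤ ((λ s a b → true) ∷ [])
        ((λ s a b → not s ∧ not a ∧ not b) ∷ (λ s a b → a) ∷ (λ s a b → b) ∷ (λ s a b → s) ∷ [])
                                                     (λ j → S j ∷ Q₁ j ∷ Q₂ j ∷ []) ⟩
    count D + (count Q₁ + (count Q₂ + count S)) ≤⟨ +-monoʳ-≤ (count D)
        (+-mono-≤ (bounded Q₁ (proj₁ members)) (+-mono-≤ (bounded Q₂ (proj₂ members)) S≤)) ⟩
    count D + (k + (k + suc (3 * length F)))    ≡⟨ cong (count D +_) (+-assoc k k _) ⟨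
    count D + (k + k + suc (3 * length F))      ∎)
    where open ≤-Reasoning

count-∩⁅⁆ : ∀ {n} (Q : Fin n → Bool) x → count (Q ∩ ⁅ x ⁆) ≡ 𝟙 (Q x)
count-∩⁅⁆ {n} Q x with Q x in Qx
... | true  = trans (count-cong only) (count-⁅⁆ x)
  where
  only : ∀ j → Q j ∧ ⁅ x ⁆ j ≡ ⁅ x ⁆ j
  only j with x ≟ j
  ... | yes refl rewrite Qx = refl
  ... | no _ = Bool.∧-zeroʳ (Q j)
... | false = trans (count-cong none) (count-∅ n)
  where
  none : ∀ j → Q j ∧ ⁅ x ⁆ j ≡ false
  none j with x ≟ j
  ... | yes refl rewrite Qx = refl
  ... | no _ = Bool.∧-zeroʳ (Q j)

𝟙-injective : ∀ {a b} → 𝟙 a ≡ 𝟙 b → a ≡ b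
𝟙-injective {true}  {true}  eq = refl
𝟙-injective {false} {false} eq = refl

-- `S` consists of `x` and `y` with opposite signs, and `z` provides room outside `S`: in no query
-- if `x` is in none, and otherwise in both `Q₁` and `Q₂`. In the latter case, if no ball outside
-- `S` avoids both queries, then a ball missed by one of them, which exists as `k < n`, lies in the
-- other and outside `S`.
twins-impossible : ∀ {n k h} {F : List (Query n)} → Successful F → IsKFamily k F → 2 ∣ k → n ≡ h + h →
  2 ≤ h → k < n → ∀ {x y z} → x ≢ y → x ≢ z → y ≢ z → deg F x ≤ 2 →
  All (λ Q → Q x ≡ Q y × Q x ≡ Q z) F → ⊥
twins-impossible {n} {k} {h} {F} success family 2∣k n≡ 2≤h k<n {x} {y} {z} x≢y x≢z y≢z deg≤2 same
  with two-queries F x deg≤2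
... | Q₁ , Q₂ , cover , kind = conclude kind
  where
  S : Fin n → Bool
  S j = ⁅ x ⁆ j ∨ ⁅ y ⁆ j
  apart : ∀ q a b → a ∧ b ≡ false → q ∧ (a ∨ b) ∧ not a ≡ q ∧ b
  apart false a     b     eq = refl
  apart true  true  false eq = refl
  apart true  false b     eq = Bool.∧-identityʳ b
  disjoint : ∀ j → ⁅ x ⁆ j ∧ ⁅ y ⁆ j ≡ false
  disjoint j with x ≟ j
  ... | no _     = refl
  ... | yes refl = ⁅⁆-≢ (x≢y ∘ sym)
  zero-sum : ∀ Q → Q x ≡ Q y → ZeroSum S ⁅ x ⁆ Q
  zero-sum Q eq = trans
    (count-≡ ((λ q a b → q ∧ (a ∨ b) ∧ a) ∷ []) ((λ q a b → q ∧ a) ∷ []) (λ j → Q j ∷ ⁅ x ⁆ j ∷ ⁅ y ⁆ j ∷ []))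
    (trans (count-∩⁅⁆ Q x) (trans (cong 𝟙 eq) (trans (sym (count-∩⁅⁆ Q y))
    (sym (count-cong (λ j → apart (Q j) (⁅ x ⁆ j) (⁅ y ⁆ j) (disjoint j)))))))
  zs : All (ZeroSum S ⁅ x ⁆) F
  zs = All.map (λ {Q} → zero-sum Q ∘ proj₁) same
  S≤h : count S ≤ h
  S≤h = ≤-trans (count-≤ ((λ a b → a ∨ b) ∷ []) ((λ a b → a) ∷ (λ a b → b) ∷ []) (λ j → ⁅ x ⁆ j ∷ ⁅ y ⁆ j ∷ []))
    (≤-trans (≤-reflexive (cong₂ _+_ (count-⁅⁆ x) (count-⁅⁆ y))) 2≤h)
  Sx : S x ≡ true
  Sx = cong (_∨ ⁅ y ⁆ x) (⁅⁆-refl x)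
  z∉S : not (S z) ≡ true
  z∉S = cong not (cong₂ _∨_ (⁅⁆-≢ x≢z) (⁅⁆-≢ y≢z))
  conclude : (Q₁ ≡ ∅ × Q₂ ≡ ∅) ⊎ (Q₁ ∈ F × Q₁ x ≡ true) × (Q₂ ∈ F × Q₂ x ≡ true) → ⊥
  conclude (inj₁ (refl , refl)) = zeroSum-impossible success n≡ S ⁅ x ⁆ zs S≤h x Sx (⁅⁆-refl x) ∅ ∅ cover
    even refl even refl (inj₁ (count-pos (∁ S ∩ ∁ ∅ ∩ ∁ ∅) z (trans (Bool.∧-identityʳ _) z∉S)))
    where
    even : 2 ∣ count {n} ∅
    even = subst (2 ∣_) (sym (count-∅ n)) (2 ∣0)
  conclude (inj₂ ((Q₁∈ , Q₁x) , (Q₂∈ , Q₂x))) =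
    zeroSum-impossible success n≡ S ⁅ x ⁆ zs S≤h x Sx (⁅⁆-refl x) Q₁ Q₂ cover
      (even Q₁∈) (All.lookup zs Q₁∈) (even Q₂∈) (All.lookup zs Q₂∈) room
    where
    even : ∀ {Q} → Q ∈ F → 2 ∣ count Q
    even Q∈ = subst (2 ∣_) (sym (All.lookup family Q∈)) 2∣k
    S⊆ : ∀ {Q} → Q ∈ F → Q x ≡ true → count (S ∩ ∁ Q) ≡ 0
    S⊆ {Q} Q∈ Qx = trans (count-cong none) (count-∅ n)
      where
      none : ∀ j → S j ∧ not (Q j) ≡ false
      none j with x ≟ j
      ... | yes refl = cong not Qx
      ... | no _ with y ≟ j
      ...   | yes refl = cong not (trans (sym (proj₁ (All.lookup same Q∈))) Qx)
      ...   | no _     = refl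
    D = ∁ S ∩ ∁ Q₁ ∩ ∁ Q₂
    V : Fin n → Vec Bool 3
    V j = S j ∷ Q₁ j ∷ Q₂ j ∷ []
    nonempty : ∀ {Q} (C : Fin n → Bool) → Q ∈ F → Q x ≡ true → count D ≡ 0 →
      count {n} (∁ ∅) ≤ count D + (count C + (count Q + count (S ∩ ∁ Q))) → 1 ≤ count C
    nonempty {Q} C Q∈ Qx D≡0 all≤ = +-cancelʳ-≤ k 1 (count C) (begin
      1 + k                                           ≤⟨ k<n ⟩
      n                                               ≡⟨ count-all n ⟨
      count {n} (∁ ∅)                                 ≤⟨ all≤ ⟩
      count D + (count C + (count Q + count (S ∩ ∁ Q)))
        ≡⟨ cong₂ (λ d s → d + (count C + (count Q + s))) D≡0 (S⊆ Q∈ Qx) ⟩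
      count C + (count Q + 0)                         ≡⟨ cong (count C +_) (+-identityʳ (count Q)) ⟩
      count C + count Q                               ≡⟨ cong (count C +_) (All.lookup family Q∈) ⟩
      count C + k                                     ∎)
      where open ≤-Reasoning
    room : HasRoom (∁ S) Q₁ Q₂
    room with 1 ≤? count D
    ... | yes 1≤D = inj₁ 1≤D
    ... | no ¬1≤D = inj₂
      ( nonempty (∁ S ∩ Q₁ ∩ ∁ Q₂) Q₂∈ Q₂x D≡0
          (count-≤ ((λ s a b → true) ∷ [])
            ((λ s a b → not s ∧ not a ∧ not b) ∷ (λ s a b → not s ∧ a ∧ not b) ∷
                (λ s a b → b) ∷ (λ s a b → s ∧ not b) ∷ []) V)
      , count-pos (∁ S ∩ Q₁ ∩ Q₂) z
          (cong₂ _∧_ z∉S (cong₂ _∧_ (trans (sym (proj₂ (All.lookup same Q₁∈))) Q₁x)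
              (trans (sym (proj₂ (All.lookup same Q₂∈))) Q₂x)))
      , nonempty (∁ S ∩ ∁ Q₁ ∩ Q₂) Q₁∈ Q₁x D≡0
          (count-≤ ((λ s a b → true) ∷ [])
            ((λ s a b → not s ∧ not a ∧ not b) ∷ (λ s a b → not s ∧ not a ∧ b) ∷
                (λ s a b → a) ∷ (λ s a b → s ∧ not a) ∷ []) V))
      where
      D≡0 : count D ≡ 0
      D≡0 = n≤0⇒n≡0 (≤-pred (≰⇒> ¬1≤D))

product-2 : ∀ {A : Set} (as : List A) → product (map (λ _ → 2) as) ≡ 2 ^ length as
product-2 []       = refl
product-2 (a ∷ as) = cong (2 *_) (product-2 as)

-- Four queries sort the balls into at most 16 classes by membership, so more than 2 · 16 balls of
-- low degree put three into one class.
small-impossible : ∀ {n k h} {F : List (Query n)} → Successful F → IsKFamily k F → 2 ∣ k → n ≡ h + h →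
  2 ≤ h → k < n → length F ≤ 4 → 32 < count (low F) → ⊥
small-impossible {n} {F = F} success family 2∣k n≡ 2≤h k<n q≤4 many
  with pigeonholes (λ Q x → 𝟙 (Q x)) (λ _ → 1) F 2 (elements (low F)) (λ Q {x} _ → 𝟙≤1 (Q x)) enough
         (Unique.filter⁺ (λ x → low F x Bool.≟ true) (Unique.allFin⁺ n))
  where
  𝟙≤1 : ∀ b → 𝟙 b ≤ 1
  𝟙≤1 true  = s≤s z≤n
  𝟙≤1 false = z≤n
  enough : 2 * product (map (λ _ → 2) F) < length (elements (low F))
  enough = ≤-<-trans (*-monoʳ-≤ 2 (≤-trans (≤-reflexive (product-2 F)) (^-monoʳ-≤ 2 q≤4)))
    (subst (32 <_) (sym (length-elements (low F))) many)
... | _ ∷ [] , s≤s () , _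
... | _ ∷ _ ∷ [] , s≤s (s≤s ()) , _
... | x ∷ y ∷ z ∷ _ , _ , ((x≢y ∷ x≢z ∷ _) ∷ (y≢z ∷ _) ∷ _) , ⊆low , same =
  twins-impossible success family 2∣k n≡ 2≤h k<n x≢y x≢z y≢z
    (low-deg F x (proj₂ (∈-filter⁻ (λ x → low F x Bool.≟ true) {xs = allFin n} (⊆low (here refl)))))
    (All.map (λ eq → 𝟙-injective (eq (here refl) (there (here refl))) ,
        𝟙-injective (eq (here refl) (there (there (here refl))))) same)

full-answers : ∀ {n} {F : List (Query n)} → IsKFamily n F → (c c' : Coloring n) → count c' ≡ count c →
  answers F c' ≡ answers F c
full-answers family c c' eq = answers-≡ {c = c} {c'} (All.map (λ {Q} Q≡n → answer-≡ {c = c} {c'} Q (inj₁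
  (trans (count-cong (λ j → cong (_∧ c' j) (full Q Q≡n j)))
  (trans eq (sym (count-cong (λ j → cong (_∧ c j) (full Q Q≡n j)))))))) family)

-- Every query is the whole set, so the answers leave open which h + 1 balls form the majority.
full-impossible : ∀ {n h} {F : List (Query n)} → Successful F → IsKFamily n F → n ≡ h + h → 2 ≤ h → ⊥
full-impossible {h = suc zero} _ _ _ (s≤s ())
full-impossible {n} {suc (suc g)} {F} success family n≡ _
    with bisect (∁ ∅) (3 + g) (1 + g) (trans (count-all n) (trans n≡ shift))
  where
  shift : (2 + g) + (2 + g) ≡ (3 + g) + (1 + g)
  shift = +-suc (2 + g) (1 + g)
... | c , c≡ , ∁c≡ with success c
...   | nothing , correct = contradiction (trans (sym c≡) (trans (¬majority⇒balanced c (correct c refl)) ∁c≡))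
    (m≢1+n+m (1 + g) {1} ∘ sym)
...   | just b , correct = <-irrefl refl (begin-strict
  n                                            <⟨ correct c' (full-answers family c c' (trans c'≡ (sym c≡))) ⟩
  2 * count (λ j → not (c' j xor c' b))        ≡⟨ cong (2 *_)
      (minority-size c' b (cong (λ e → not e ∧ u b) (⁅⁆-refl b))) ⟩
  2 * count (∁ c')                             ≡⟨ cong (2 *_) ∁c'≡ ⟩
  2 * (1 + g)                                  ≤⟨ *-monoʳ-≤ 2 (n≤1+n (1 + g)) ⟩
  2 * (2 + g)                                  ≡⟨ cong (2 + g +_) (+-identityʳ (2 + g)) ⟩
  (2 + g) + (2 + g)                            ≡⟨ n≡ ⟨
  n                                            ∎)
  where
  open ≤-Reasoning
  others : count (∁ ⁅ b ⁆) ≡ (3 + g) + g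
  others = suc-injective (trans (cong (_+ count (∁ ⁅ b ⁆)) (sym (count-⁅⁆ b)))
      (trans (count-∁ ⁅ b ⁆) (trans n≡ (shift g))))
    where
    shift : ∀ g → (2 + g) + (2 + g) ≡ suc ((3 + g) + g)
    shift = solve-∀
  -- All h + 1 = 3 + g majority balls are taken from the balls other than `b`, which puts `b` among
  -- the remaining h - 1.
  half = bisect (∁ ⁅ b ⁆) (3 + g) g others
  u = proj₁ half
  c' : Coloring n
  c' = ∁ ⁅ b ⁆ ∩ u
  c'≡ : count c' ≡ 3 + g
  c'≡ = proj₁ (proj₂ half)
  ∁c'≡ : count (∁ c') ≡ 1 + g
  ∁c'≡ = +-cancelˡ-≡ (3 + g) _ _ (trans (cong (_+ count (∁ c')) (sym c'≡))
      (trans (count-∁ c') (trans n≡ (shift g))))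
    where
    shift : ∀ g → (2 + g) + (2 + g) ≡ (3 + g) + (1 + g)
    shift = solve-∀

-- The bound 11 n ≤ 5 k |F| and its two consequences

lower-bound : ∀ {n k} {F : List (Query n)} → 2 ∣ k → 200 < k → 2 ∣ n → k ≤ n →
  IsKFamily k F → Successful F → 11 * n ≤ 5 * (k * length F)
lower-bound {n} {k} {F} 2∣k 200<k 2∣n k≤n family success = ≮⇒≥ λ few → contradiction few impossible
  where
  open ≤-Reasoning
  q m h : ℕ
  q = length F
  m = count (low F)
  h = proj₁ (even⇒half 2∣n)
  n≡ : n ≡ h + h
  n≡ = proj₂ (even⇒half 2∣n)
  200<n : 200 < n
  200<n = <-≤-trans 200<k k≤n
  n≡2h : n ≡ 2 * h
  n≡2h = trans n≡ (cong (h +_) (sym (+-identityʳ h)))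
  2≤h : 2 ≤ h
  2≤h = *-cancelˡ-≤ 2 (≤-trans (≤-trans (≤ᵇ⇒≤ 4 201 _) 200<n) (≤-reflexive n≡2h))
  impossible : ¬ (5 * (k * q) < 11 * n)
  impossible few = case (k ℕ.≟ n) of λ where
      (yes refl) → full-impossible success family n≡ 2≤h
      (no k≢n) → case (k + k + suc (3 * q) <? n) of λ where
        (yes room) → large-impossible success family 2∣k n≡ 3q<m 3q<h room
        (no ¬room) → small-impossible success family 2∣k n≡ 2≤h (≤∧≢⇒< k≤n k≢n)
                       (≮⇒≥ (q≯4 (≮⇒≥ ¬room))) 32<m
    where
    4n<15m : 4 * n < 15 * m
    4n<15m = +-cancelʳ-< (11 * n) _ _ (begin-strict
      4 * n + 11 * n          ≡⟨ *-distribʳ-+ n 4 11 ⟨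
      15 * n                  ≡⟨ *-assoc 5 3 n ⟩
      5 * (3 * n)             ≤⟨ *-monoʳ-≤ 5 (low-count F family) ⟩
      5 * (3 * m + q * k)     ≡⟨ split m k q ⟩
      15 * m + 5 * (k * q)    <⟨ +-monoʳ-< (15 * m) few ⟩
      15 * m + 11 * n         ∎)
      where
      split : ∀ m k q → 5 * (3 * m + q * k) ≡ 15 * m + 5 * (k * q)
      split = solve-∀
    -- The factor 91 fits because 11 · 91 = 1001 is just below 5 · 201 = 1005; it is ample for both
    -- `3q<m` and `3q<h`.
    91q<n : 91 * q < n
    91q<n = *-cancelˡ-< 11 _ _ (begin-strict
      11 * (91 * q)   ≡⟨ *-assoc 11 91 q ⟨
      1001 * q        ≤⟨ *-monoˡ-≤ q (≤ᵇ⇒≤ 1001 1005 _) ⟩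
      1005 * q        ≡⟨ *-assoc 5 201 q ⟩
      5 * (201 * q)   ≤⟨ *-monoʳ-≤ 5 (*-monoˡ-≤ q 200<k) ⟩
      5 * (k * q)     <⟨ few ⟩
      11 * n          ∎)
    3q<m : 3 * q < m
    3q<m = *-cancelˡ-< 15 _ _ (begin-strict
      15 * (3 * q)    ≡⟨ *-assoc 15 3 q ⟨
      45 * q          ≤⟨ *-monoˡ-≤ q (≤ᵇ⇒≤ 45 91 _) ⟩
      91 * q          <⟨ 91q<n ⟩
      n               ≤⟨ m≤n*m n 4 ⟩
      4 * n           <⟨ 4n<15m ⟩
      15 * m          ∎)
    3q<h : 3 * q < h
    3q<h = *-cancelˡ-≤ 4 (begin
      4 * suc (3 * q)   ≡⟨ expand q ⟩
      4 + 12 * q        ≤⟨ +-mono-≤ (≤-trans (≤ᵇ⇒≤ 4 201 _) 200<n) (*-monoˡ-≤ q (≤ᵇ⇒≤ 12 91 _)) ⟩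
      n + 91 * q        ≤⟨ +-monoʳ-≤ n (<⇒≤ 91q<n) ⟩
      n + n             ≡⟨ cong₂ _+_ n≡2h n≡2h ⟩
      2 * h + 2 * h     ≡⟨ *-distribʳ-+ h 2 2 ⟨
      4 * h             ∎)
      where
      expand : ∀ q → 4 * suc (3 * q) ≡ 4 + 12 * q
      expand = solve-∀
    32<m : 32 < m
    32<m = *-cancelˡ-< 15 _ _ (begin-strict
      480       ≤⟨ ≤ᵇ⇒≤ 480 804 _ ⟩
      4 * 201   ≤⟨ *-monoʳ-≤ 4 200<n ⟩
      4 * n     <⟨ 4n<15m ⟩
      15 * m    ∎)
    -- With this bound on `n`, `few` becomes 5kq < 22k + 33q + 11. At q = 5 + p the left side is 25k
    -- + 5kp, which is too large once k > 200.
    q≯4 : n ≤ k + k + suc (3 * q) → ¬ 4 < q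
    q≯4 n≤ 4<q = <-irrefl refl (begin-strict
      5 * (k * q)                             ≡⟨ cong (λ z → 5 * (k * z)) q≡ ⟩
      5 * (k * (5 + p))                       <⟨ subst (λ z → 5 * (k * z) < 11 * n) q≡ few ⟩
      11 * n                                  ≤⟨ *-monoʳ-≤ 11 n≤ ⟩
      11 * (k + k + suc (3 * q))              ≡⟨ cong (λ z → 11 * (k + k + suc (3 * z))) q≡ ⟩
      11 * (k + k + suc (3 * (5 + p)))        ≡⟨ expand₁ k p ⟩
      22 * k + (176 + 33 * p)                 ≤⟨ +-monoʳ-≤ (22 * k) (+-mono-≤
                                                   (≤-trans (≤ᵇ⇒≤ 176 603 _) (*-monoʳ-≤ 3 200<k))
                                                   (*-monoˡ-≤ p (≤-trans (≤ᵇ⇒≤ 33 1005 _)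
                                                       (*-monoʳ-≤ 5 200<k)))) ⟩
      22 * k + (3 * k + 5 * k * p)            ≡⟨ expand₂ k p ⟩
      5 * (k * (5 + p))                       ≡⟨ cong (λ z → 5 * (k * z)) q≡ ⟨
      5 * (k * q)                             ∎)
      where
      p : ℕ
      p = q ∸ 5
      q≡ : q ≡ 5 + p
      q≡ = sym (m+[n∸m]≡n 4<q)
      expand₁ : ∀ k p → 11 * (k + k + suc (3 * (5 + p))) ≡ 22 * k + (176 + 33 * p)
      expand₁ = solve-∀
      expand₂ : ∀ k p → 22 * k + (3 * k + 5 * k * p) ≡ 5 * (k * (5 + p))
      expand₂ = solve-∀

-- Discarding the subtracted terms only enlarges the left side. Five times the remaining factor is
-- 22ik + 3ik + 5i + 5i²; since k < 2i, the term 3ik is at most 6i², and adding 28i completes the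
-- sum to 11 i (2k + 3 + i).
integer-bound : ∀ n k i q → k < 2 * i → 11 * n ≤ 5 * (k * q) →
  n * (5 * i * k ∸ k + i + i * i) ∸ 2 * (k ∸ i) ≤ q * ((2 * k + 3 + i) * i * k)
integer-bound n k i q k<2i bound = ≤-trans (m∸n≤m _ (2 * (k ∸ i))) (*-cancelˡ-≤ 5 (begin
  5 * (n * (5 * i * k ∸ k + i + i * i))
    ≤⟨ *-monoʳ-≤ 5 (*-monoʳ-≤ n (+-monoˡ-≤ (i * i) (+-monoˡ-≤ i (m∸n≤m (5 * i * k) k)))) ⟩
  5 * (n * (5 * i * k + i + i * i))
    ≡⟨ expand₁ n k i ⟩
  n * (22 * (i * k) + 5 * i + 5 * (i * i) + 3 * i * k)
    ≤⟨ *-monoʳ-≤ n (+-monoʳ-≤ (22 * (i * k) + 5 * i + 5 * (i * i)) (*-monoʳ-≤ (3 * i) (<⇒≤ k<2i))) ⟩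
  n * (22 * (i * k) + 5 * i + 5 * (i * i) + 3 * i * (2 * i))
    ≤⟨ *-monoʳ-≤ n (m≤m+n _ (28 * i)) ⟩
  n * (22 * (i * k) + 5 * i + 5 * (i * i) + 3 * i * (2 * i) + 28 * i)
    ≡⟨ expand₂ n k i ⟩
  11 * n * ((2 * k + 3 + i) * i)
    ≤⟨ *-monoˡ-≤ ((2 * k + 3 + i) * i) bound ⟩
  5 * (k * q) * ((2 * k + 3 + i) * i)
    ≡⟨ expand₃ k i q ⟩
  5 * (q * ((2 * k + 3 + i) * i * k)) ∎))
  where
  open ≤-Reasoning
  expand₁ : ∀ n k i → 5 * (n * (5 * i * k + i + i * i)) ≡ n * (22 * (i * k) + 5 * i + 5 * (i * i) + 3 * i * k)
  expand₁ = solve-∀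
  expand₂ : ∀ n k i → n * (22 * (i * k) + 5 * i + 5 * (i * i) + 3 * i * (2 * i) + 28 * i)
      ≡ 11 * n * ((2 * k + 3 + i) * i)
  expand₂ = solve-∀
  expand₃ : ∀ k i q → 5 * (k * q) * ((2 * k + 3 + i) * i) ≡ 5 * (q * ((2 * k + 3 + i) * i * k))
  expand₃ = solve-∀

-- The integer constructor +_ would make sections such as (m +_) ambiguous further up.
open import Data.Integer using (+_)
import Data.Integer as ℤ
import Data.Integer.Properties as ℤ
open import Data.Rational using (ℚ; _/_; _-_) renaming (_<_ to _<ℚ_)
open import Data.Rational using () renaming (_*_ to _*ℚ_)
import Data.Rational as ℚ
import Data.Rational.Properties as ℚ
import Data.Rational.Unnormalised as ℚᵘ
import Data.Rational.Unnormalised.Properties as ℚᵘ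

-- Normalised fractions with a variable numerator do not compute, so the comparison passes to
-- unnormalised ones, where it is a cross-multiplied inequality of integers.
rational-bound : ∀ n m → 11 * n ≤ 5 * m → ((+ 11 / 5) *ℚ (+ n / 1)) ℚ.≤ (+ m / 1)
rational-bound n m bound = ℚ.toℚᵘ-cancel-≤ (begin
  ℚ.toℚᵘ ((+ 11 / 5) *ℚ (+ n / 1))             ≃⟨ ℚ.toℚᵘ-homo-* (+ 11 / 5) (+ n / 1) ⟩
  ℚᵘ.mkℚᵘ (+ 11) 4 ℚᵘ.* ℚ.toℚᵘ (+ n / 1)       ≃⟨ ℚᵘ.*-congˡ {ℚᵘ.mkℚᵘ (+ 11) 4}
      (ℚ.toℚᵘ-fromℚᵘ (ℚᵘ.mkℚᵘ (+ n) 0)) ⟩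
  ℚᵘ.mkℚᵘ (+ 11) 4 ℚᵘ.* ℚᵘ.mkℚᵘ (+ n) 0        ≤⟨ ℚᵘ.*≤* cross ⟩
  ℚᵘ.mkℚᵘ (+ m) 0                              ≃⟨ ℚ.toℚᵘ-fromℚᵘ (ℚᵘ.mkℚᵘ (+ m) 0) ⟨
  ℚ.toℚᵘ (+ m / 1)                             ∎)
  where
  open ℚᵘ.≤-Reasoning
  cross : (+ 11 ℤ.* + n) ℤ.* + 1 ℤ.≤ + m ℤ.* + 5
  cross = subst₂ ℤ._≤_
    (trans (ℤ.pos-* 11 n) (sym (ℤ.*-identityʳ (+ 11 ℤ.* + n))))
    (trans (ℤ.pos-* 5 m) (ℤ.*-comm (+ 5) (+ m)))
    (ℤ.+≤+ bound)

theorem8 : (∃ λ (k₁ : ℕ) → ∀ (k n i : ℕ) → 2 ∣ k → k₁ < k → 2 ∣ n → k ≤ n →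
    k < 2 * i → i < k →
    ∀ (F : List (Query n)) → IsKFamily k F → Successful F →
    n * (5 * i * k ∸ k + i + i * i) ∸ 2 * (k ∸ i)
    ≤ length F * ((2 * k + 3 + i) * i * k))
    ×
    (∀ (ε : ℚ) → (+ 0 / 1) <ℚ ε →
    ∃ λ (k₀ : ℕ) → ∀ (k : ℕ) → 2 ∣ k → k₀ < k →
    ∃ λ (n₀ : ℕ) → ∀ (n : ℕ) → 2 ∣ n → n₀ < n →
    ∀ (F : List (Query n)) → IsKFamily k F → Successful F →
    (((+ 11 / 5) - ε) *ℚ (+ n / 1)) <ℚ (+ (length F * k) / 1))
theorem8 =
  (200 , λ k n i 2∣k 200<k 2∣n k≤n k<2i _ F family success →
    integer-bound n k i (length F) k<2i (lower-bound 2∣k 200<k 2∣n k≤n family success)) ,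
  -- Taking `n₀ = k` yields both `k ≤ n` and a positive `n`; the latter lets `ε` make the inequality
  -- strict.
  λ ε 0<ε → 200 , λ k 2∣k 200<k → k , λ n 2∣n k<n F family success →
    ℚ.<-≤-trans (less ε n 0<ε (≤-<-trans z≤n k<n))
      (rational-bound n (length F * k)
        (≤-trans (lower-bound 2∣k 200<k 2∣n (<⇒≤ k<n) family success)
          (≤-reflexive (cong (5 *_) (*-comm k (length F))))))
  where
  less : ∀ ε n → (+ 0 / 1) <ℚ ε → 0 < n → (((+ 11 / 5) - ε) *ℚ (+ n / 1)) <ℚ ((+ 11 / 5) *ℚ (+ n / 1))
  less ε (suc n) 0<ε _ = ℚ.*-monoˡ-<-pos (+ suc n / 1) {{ℚ.normalize-pos (suc n) 1}}
    (subst (((+ 11 / 5) - ε) <ℚ_) (ℚ.+-identityʳ (+ 11 / 5)) (ℚ.+-monoʳ-< (+ 11 / 5) (ℚ.neg-antimono-< 0<ε)))
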